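{- Let $E=\{x_1,\dots,x_n\}\subset\mathbb{R}^2$ with $x_i\,\mathcal{I}\,x_j$ for all $i\neq j$. The Max-Min $p$-dispersion problem is polynomially solvable to optimality in $E$. For $p=2$ and $p=3$ it is solvable in $O(n)$ time using $O(1)$ additional memory space. For $p>3$ there is an algorithm (a dynamic programming algorithm) that solves it, returning the optimal value and an optimal selection of $p$ points, in $O(pn\log n)$ time and $O(n)$ memory space.
   Context: For $y=(y^1,y^2),z=(z^1,z^2)\in\mathbb{R}^2$ write $y\prec z$ iff $y^1<z^1$ and $y^2>z^2$, and $y\,\mathcal{I}\,z$ iff $y\prec z$ or $z\prec y$ (so $E$ is a two-dimensional Pareto front). Fix $\alpha>0$ and let $d$ be the Euclidean distance on $\mathbb{R}^2$. For an integer $2\le p\le n$, let $D_p$ be the set of $p$-tuples $(z_1,\dots,z_p)\in E^p$ of pairwise distinct points. The Max-Min $p$-dispersion problem is $\max_{(z_1,\dots,z_p)\in D_p}\min_{1\le i<j\le p}d(z_i,z_j)^\alpha$. Complexities are in a model where arithmetic operations, comparisons and evaluation of $d(\cdot,\cdot)^\alpha$ take $O(1)$ time; "additional memory space" excludes the storage of the input. -}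

module Defs where

open import Algebra.Bundles using (CommutativeRing)
open import Data.Bool using (Bool; true; false; not; _∧_)
open import Data.Fin using (Fin; zero; toℕ; fromℕ<)
import Data.Fin as Fin
import Data.Fin.Properties as Finₚ
open import Data.Nat using (ℕ; zero; suc; _≤_; _<_; _+_; _*_; _∸_; _^_; _/_; _<?_)
import Data.Nat.Properties as ℕₚ
open import Data.Product using (Σ; ∃; ∃-syntax; _×_; _,_; proj₁; proj₂)
open import Data.Sum using (_⊎_)
open import Data.Unit using (⊤)
open import Level using (0ℓ)
open import Relation.Binary.Core using (Rel)
open import Relation.Binary.Structures using (IsStrictTotalOrder)
open import Relation.Binary.PropositionalEquality using (_≡_; _≢_)
open import Relation.Nullary using (¬_; yes; no; does)
import Relation.Binary.Construct.StrictToNonStrict as ToNonStrict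

-- The (classical) real numbers: a Dedekind-complete ordered field.  These
-- axioms determine the structure up to isomorphism, and those for sqrt and _^ʳ_
-- determine x ↦ √x on x ≥ 0 and (x , a) ↦ xᵃ on x > 0 (and 0ᵃ for a > 0);
-- values of _⁻¹, sqrt and _^ʳ_ elsewhere are unspecified.
record RealNumbers : Set₁ where
  field
    commutativeRing : CommutativeRing 0ℓ 0ℓ

  open CommutativeRing commutativeRing public
    using (Carrier; _≈_; 0#; 1#)
    renaming (_+_ to _+ʳ_; _*_ to _*ʳ_; _-_ to _-ʳ_)

  infix 4 _<ʳ_
  infix 8 _⁻¹
  infixr 8 _^ʳ_

  field
    _<ʳ_               : Rel Carrier 0ℓ
    isStrictTotalOrder : IsStrictTotalOrder _≈_ _<ʳ_

  open IsStrictTotalOrder isStrictTotalOrder public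
    using () renaming (compare to compareʳ; _<?_ to _<ʳ?_)

  open ToNonStrict _≈_ _<ʳ_ public using () renaming (_≤_ to _≤ʳ_)

  IsUpperBound : (Carrier → Set) → Carrier → Set
  IsUpperBound P b = ∀ x → P x → x ≤ʳ b

  field
    0≉1       : ¬ (0# ≈ 1#)
    +-mono-<  : ∀ {x y} z → x <ʳ y → x +ʳ z <ʳ y +ʳ z
    *-pos     : ∀ {x y} → 0# <ʳ x → 0# <ʳ y → 0# <ʳ x *ʳ y

    _⁻¹       : Carrier → Carrier
    *-inverse : ∀ {x} → ¬ (x ≈ 0#) → x *ʳ x ⁻¹ ≈ 1#

    supremum  : (P : Carrier → Set) → ∃ P → ∃ (IsUpperBound P) →
                ∃[ s ] (IsUpperBound P s × (∀ b → IsUpperBound P b → s ≤ʳ b))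

    sqrt      : Carrier → Carrier
    sqrt-nonneg : ∀ {x} → 0# ≤ʳ x → 0# ≤ʳ sqrt x
    sqrt-square : ∀ {x} → 0# ≤ʳ x → sqrt x *ʳ sqrt x ≈ x

    _^ʳ_      : Carrier → Carrier → Carrier
    ^-cong    : ∀ {x y a b} → x ≈ y → a ≈ b → x ^ʳ a ≈ y ^ʳ b
    ^-pos     : ∀ {x} a → 0# <ʳ x → 0# <ʳ x ^ʳ a
    ^-one     : ∀ {x} → 0# <ʳ x → x ^ʳ 1# ≈ x
    ^-+       : ∀ {x} a b → 0# <ʳ x → x ^ʳ (a +ʳ b) ≈ x ^ʳ a *ʳ x ^ʳ b
    *-^       : ∀ {x y} a → 0# <ʳ x → 0# <ʳ y → (x *ʳ y) ^ʳ a ≈ x ^ʳ a *ʳ y ^ʳ a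
    0-^       : ∀ {a} → 0# <ʳ a → 0# ^ʳ a ≈ 0#
    ^-mono-<  : ∀ {x y a} → 0# <ʳ a → 0# <ʳ x → x <ʳ y → x ^ʳ a <ʳ y ^ʳ a

------------------------------------------------------------------------
-- The dispersion problem

module Problem (R : RealNumbers) (α : RealNumbers.Carrier R) where
  open RealNumbers R

  Point : Set
  Point = Carrier × Carrier

  infix 4 _≈ₚ_ _≺_ _𝓘_

  _≈ₚ_ : Point → Point → Set
  (y¹ , y²) ≈ₚ (z¹ , z²) = (y¹ ≈ z¹) × (y² ≈ z²)

  _≺_ : Point → Point → Set
  (y¹ , y²) ≺ (z¹ , z²) = (y¹ <ʳ z¹) × (z² <ʳ y²)

  _𝓘_ : Point → Point → Set
  y 𝓘 z = (y ≺ z) ⊎ (z ≺ y)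

  dist : Point → Point → Carrier
  dist (y¹ , y²) (z¹ , z²) =
    sqrt ((y¹ -ʳ z¹) *ʳ (y¹ -ʳ z¹) +ʳ (y² -ʳ z²) *ʳ (y² -ʳ z²))

  dist^α : Point → Point → Carrier
  dist^α y z = dist y z ^ʳ α

  IsMinimum : (Carrier → Set) → Carrier → Set
  IsMinimum P m = P m × (∀ v → P v → m ≤ʳ v)

  IsMaximum : (Carrier → Set) → Carrier → Set
  IsMaximum P m = P m × (∀ v → P v → v ≤ʳ m)

  IsParetoFront : ∀ {n} → (Fin n → Point) → Set
  IsParetoFront x = ∀ i j → i ≢ j → x i 𝓘 x j

  IsPairDistance : ∀ {p} → (Fin p → Point) → Carrier → Set
  IsPairDistance z v = ∃[ i ] ∃[ j ] ((i Fin.< j) × (v ≈ dist^α (z i) (z j)))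

  IsDispersion : ∀ {p} → (Fin p → Point) → Carrier → Set
  IsDispersion z = IsMinimum (IsPairDistance z)

  InD : ∀ {n p} → (Fin n → Point) → (Fin p → Point) → Set
  InD x z = (∀ i → ∃[ j ] (z i ≈ₚ x j)) × (∀ i j → i ≢ j → ¬ (z i ≈ₚ z j))

  IsOptimalValue : ∀ {n} → (Fin n → Point) → ℕ → Carrier → Set
  IsOptimalValue x p =
    IsMaximum (λ v → ∃[ z ] (InD {p = p} x z × IsDispersion z v))

------------------------------------------------------------------------
-- A real random-access machine, programmed in a while language.
-- A program has k named arrays of naturals and l named arrays of reals.

data IntOp : Set where
  plus monus times quot : IntOp

data RealOp : Set where
  plus minus times quot : RealOp

data IExp (k : ℕ) : Set where
  const   : ℕ → IExp k
  #points : IExp k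
  #chosen : IExp k
  load    : Fin k → IExp k → IExp k
  op      : IntOp → IExp k → IExp k → IExp k

data RExp (k l : ℕ) : Set where
  zeroʳ oneʳ : RExp k l
  load       : Fin l → IExp k → RExp k l
  coord₁     : IExp k → RExp k l
  coord₂     : IExp k → RExp k l
  op         : RealOp → RExp k l → RExp k l → RExp k l
  -- the value of d(·,·)^α at the points (a , b) and (c , d)
  distance^α : (a b c d : RExp k l) → RExp k l

data BExp (k l : ℕ) : Set where
  ltⁱ  : IExp k → IExp k → BExp k l
  ltʳ  : RExp k l → RExp k l → BExp k l
  notᵇ : BExp k l → BExp k l
  andᵇ : BExp k l → BExp k l → BExp k l

infixr 5 _⨾_

data Cmd (k l : ℕ) : Set where
  skip        : Cmd k l
  storeⁱ      : Fin k → IExp k → IExp k → Cmd k l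
  storeʳ      : Fin l → IExp k → RExp k l → Cmd k l
  _⨾_         : Cmd k l → Cmd k l → Cmd k l
  ifᵇ_then_else_ : BExp k l → Cmd k l → Cmd k l → Cmd k l
  while_loop_ : BExp k l → Cmd k l → Cmd k l

-- At least one array of each kind: those numbered zero hold the output.
record Program : Set where
  field
    {k l} : ℕ
    code  : Cmd (suc k) (suc l)

costⁱ : ∀ {k} → IExp k → ℕ
costⁱ (const _)  = 1
costⁱ #points    = 1
costⁱ #chosen    = 1
costⁱ (load _ e) = 1 + costⁱ e
costⁱ (op _ e f) = 1 + costⁱ e + costⁱ f

costʳ : ∀ {k l} → RExp k l → ℕ
costʳ zeroʳ      = 1
costʳ oneʳ       = 1
costʳ (load _ e) = 1 + costⁱ e
costʳ (coord₁ e) = 1 + costⁱ e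
costʳ (coord₂ e) = 1 + costⁱ e
costʳ (op _ e f) = 1 + costʳ e + costʳ f
costʳ (distance^α a b c d) = 1 + costʳ a + costʳ b + costʳ c + costʳ d

costᵇ : ∀ {k l} → BExp k l → ℕ
costᵇ (ltⁱ e f)  = 1 + costⁱ e + costⁱ f
costᵇ (ltʳ e f)  = 1 + costʳ e + costʳ f
costᵇ (notᵇ b)   = 1 + costᵇ b
costᵇ (andᵇ b c) = 1 + costᵇ b + costᵇ c

update : ∀ {k} {A : Set} → (Fin k → ℕ → A) → Fin k → ℕ → A → Fin k → ℕ → A
update m a i v b j with a Finₚ.≟ b | i ℕₚ.≟ j
... | yes _ | yes _ = v
... | _     | _     = m b j

-- The input is read-only.  W bounds every natural that may be computed or
-- stored, so that integer cells are O(log W)-bit words; S is the length of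
-- each array.  Evaluation is total with junk values, but a command can only
-- be executed when the expressions it evaluates are safe.
module Machine (R : RealNumbers) (α : RealNumbers.Carrier R)
               (W S p : ℕ) {n : ℕ} (x : Fin n → Problem.Point R α) where
  open RealNumbers R
  open Problem R α

  record State (k l : ℕ) : Set where
    constructor ⟪_,_⟫
    field
      ints  : Fin k → ℕ → ℕ
      reals : Fin l → ℕ → Carrier
  open State public

  initial : ∀ {k l} → State k l
  initial = ⟪ (λ _ _ → 0) , (λ _ _ → 0#) ⟫

  inputPoint : ℕ → Point
  inputPoint i with i <? n
  ... | yes i<n = x (fromℕ< i<n)
  ... | no  _   = 0# , 0#

  applyⁱ : IntOp → ℕ → ℕ → ℕ
  applyⁱ plus  a b       = a + b
  applyⁱ monus a b       = a ∸ b
  applyⁱ times a b       = a * b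
  applyⁱ quot  a zero    = 0
  applyⁱ quot  a (suc b) = a / suc b

  definedⁱ : IntOp → ℕ → Set
  definedⁱ quot b = b ≢ 0
  definedⁱ _    _ = ⊤

  applyʳ : RealOp → Carrier → Carrier → Carrier
  applyʳ plus  a b = a +ʳ b
  applyʳ minus a b = a -ʳ b
  applyʳ times a b = a *ʳ b
  applyʳ quot  a b = a *ʳ b ⁻¹

  definedʳ : RealOp → Carrier → Set
  definedʳ quot b = ¬ (b ≈ 0#)
  definedʳ _    _ = ⊤

  module _ {k l} (s : State k l) where

    evalⁱ : IExp k → ℕ
    evalⁱ (const m)  = m
    evalⁱ #points    = n
    evalⁱ #chosen    = p
    evalⁱ (load a e) = ints s a (evalⁱ e)
    evalⁱ (op o e f) = applyⁱ o (evalⁱ e) (evalⁱ f)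

    evalʳ : RExp k l → Carrier
    evalʳ zeroʳ      = 0#
    evalʳ oneʳ       = 1#
    evalʳ (load a e) = reals s a (evalⁱ e)
    evalʳ (coord₁ e) = proj₁ (inputPoint (evalⁱ e))
    evalʳ (coord₂ e) = proj₂ (inputPoint (evalⁱ e))
    evalʳ (op o e f) = applyʳ o (evalʳ e) (evalʳ f)
    evalʳ (distance^α a b c d) = dist^α (evalʳ a , evalʳ b) (evalʳ c , evalʳ d)

    evalᵇ : BExp k l → Bool
    evalᵇ (ltⁱ e f)  = does (evalⁱ e <? evalⁱ f)
    evalᵇ (ltʳ e f)  = does (evalʳ e <ʳ? evalʳ f)
    evalᵇ (notᵇ b)   = not (evalᵇ b)
    evalᵇ (andᵇ b c) = evalᵇ b ∧ evalᵇ c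

    safeⁱ : IExp k → Set
    safeⁱ (const m)  = m ≤ W
    safeⁱ #points    = n ≤ W
    safeⁱ #chosen    = p ≤ W
    safeⁱ (load a e) = safeⁱ e × evalⁱ e < S
    safeⁱ (op o e f) = safeⁱ e × safeⁱ f × definedⁱ o (evalⁱ f) ×
                       evalⁱ (op o e f) ≤ W

    safeʳ : RExp k l → Set
    safeʳ zeroʳ      = ⊤
    safeʳ oneʳ       = ⊤
    safeʳ (load a e) = safeⁱ e × evalⁱ e < S
    safeʳ (coord₁ e) = safeⁱ e × evalⁱ e < n
    safeʳ (coord₂ e) = safeⁱ e × evalⁱ e < n
    safeʳ (op o e f) = safeʳ e × safeʳ f × definedʳ o (evalʳ f)
    safeʳ (distance^α a b c d) = safeʳ a × safeʳ b × safeʳ c × safeʳ d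

    safeᵇ : BExp k l → Set
    safeᵇ (ltⁱ e f)  = safeⁱ e × safeⁱ f
    safeᵇ (ltʳ e f)  = safeʳ e × safeʳ f
    safeᵇ (notᵇ b)   = safeᵇ b
    safeᵇ (andᵇ b c) = safeᵇ b × (evalᵇ b ≡ true → safeᵇ c)

  infix 3 ⟨_,_⟩⇓⟨_,_⟩

  -- ⟨ c , s ⟩⇓⟨ t , s′ ⟩: started in s, c halts in s′ after t steps.
  data ⟨_,_⟩⇓⟨_,_⟩ {k l} : Cmd k l → State k l → ℕ → State k l → Set where
    skip   : ∀ {s} → ⟨ skip , s ⟩⇓⟨ 1 , s ⟩
    storeⁱ : ∀ {s a e f} → safeⁱ s e → evalⁱ s e < S → safeⁱ s f →
             ⟨ storeⁱ a e f , s ⟩⇓⟨ 1 + costⁱ e + costⁱ f ,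
               ⟪ update (ints s) a (evalⁱ s e) (evalⁱ s f) , reals s ⟫ ⟩
    storeʳ : ∀ {s a e f} → safeⁱ s e → evalⁱ s e < S → safeʳ s f →
             ⟨ storeʳ a e f , s ⟩⇓⟨ 1 + costⁱ e + costʳ f ,
               ⟪ ints s , update (reals s) a (evalⁱ s e) (evalʳ s f) ⟫ ⟩
    _⨾_    : ∀ {c d s s′ s″ t u} →
             ⟨ c , s ⟩⇓⟨ t , s′ ⟩ → ⟨ d , s′ ⟩⇓⟨ u , s″ ⟩ →
             ⟨ c ⨾ d , s ⟩⇓⟨ t + u , s″ ⟩
    if-true  : ∀ {b c d s s′ t} → safeᵇ s b → evalᵇ s b ≡ true →
               ⟨ c , s ⟩⇓⟨ t , s′ ⟩ →
               ⟨ ifᵇ b then c else d , s ⟩⇓⟨ 1 + costᵇ b + t , s′ ⟩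
    if-false : ∀ {b c d s s′ t} → safeᵇ s b → evalᵇ s b ≡ false →
               ⟨ d , s ⟩⇓⟨ t , s′ ⟩ →
               ⟨ ifᵇ b then c else d , s ⟩⇓⟨ 1 + costᵇ b + t , s′ ⟩
    while-true  : ∀ {b c s s′ s″ t u} → safeᵇ s b → evalᵇ s b ≡ true →
                  ⟨ c , s ⟩⇓⟨ t , s′ ⟩ → ⟨ while b loop c , s′ ⟩⇓⟨ u , s″ ⟩ →
                  ⟨ while b loop c , s ⟩⇓⟨ 1 + costᵇ b + t + u , s″ ⟩
    while-false : ∀ {b c s} → safeᵇ s b → evalᵇ s b ≡ false →
                  ⟨ while b loop c , s ⟩⇓⟨ 1 + costᵇ b , s ⟩

  -- The first real cell holds the optimal value, and the first p integer
  -- cells hold the 0-based indices of an optimal selection.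
  Output : ∀ {k l} → State (suc k) (suc l) → Set
  Output s = p ≤ S × IsOptimalValue x p (reals s zero 0) ×
    Σ (Fin p → Fin n) λ σ →
      (∀ i → ints s zero (toℕ i) ≡ toℕ (σ i)) ×
      InD x (λ i → x (σ i)) × IsDispersion (λ i → x (σ i)) (reals s zero 0)

------------------------------------------------------------------------
-- Complexity

module Complexity (R : RealNumbers) (α : RealNumbers.Carrier R) where
  open Problem R α

  -- Every allocated array cell is counted as memory, output cells included.
  SolvesWithin : Program → (W T M p : ℕ) → ∀ {n} → (Fin n → Point) → Set
  SolvesWithin P W T M p x =
    ∃[ S ] ((suc k + suc l) * S ≤ M ×
      (let open Machine R α W S p x in
       ∃[ t ] ∃[ s ] (⟨ code , initial ⟩⇓⟨ t , s ⟩ × t ≤ T × Output s)))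
    where open Program P

  -- One program solves the problem for all n and p with A p, in
  -- O(T n p) time and O(M n p) memory, on words of O(log n) bits.
  SolvableIn : (A : ℕ → Set) (T M : ℕ → ℕ → ℕ) → Set
  SolvableIn A T M =
    Σ Program λ P → ∃[ c ] (∀ n p → 2 ≤ p → p ≤ n → A p →
      (x : Fin n → Point) → IsParetoFront x →
      SolvesWithin P (n ^ c) (c * T n p) (c * M n p) p x)

{-# OPTIONS --safe #-}

-- Along the front, sorted by abscissa, distances shrink with the interval they
-- span, so the dispersion of a selection is its least gap between neighbours and
-- an optimal selection is a path of p − 1 gaps ending at the last point.  With
-- F k i the best least gap over paths of k gaps ending at i,
-- F (k + 1) i = max_{j ≤ i} min (F k j) (d j i); the first term increases and the
-- second decreases in j, so the best j is found at the crossing, which moves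
-- monotonically with i.  A row therefore takes O(n) time, and going from right to
-- left it can be computed in place; given the optimal value, a greedy walk back
-- from the last point recovers a selection in O(n) time.  Together with a merge
-- sort this is O(pn + n log n) time and O(n) memory.  For p = 2 and p = 3 the extreme
-- points belong to an optimal selection, and linear scans suffice.
module Submission where

open import Defs
open import Algebra.Bundles using (CommutativeRing)
import Algebra.Properties.Ring as RingProperties
open import Data.Bool using (Bool; true; false; not)
open import Data.Empty using (⊥)
open import Data.Fin using (Fin; zero; suc; toℕ; fromℕ<; inject₁; punchIn; punchOut)
import Data.Fin as Fin
import Data.Fin.Properties as Finₚ
open import Data.Nat using (ℕ; zero; suc; _+_; _*_; _∸_; _^_; _≤_; _<_; _<?_; z≤n; s≤s; z<s; s<s; s≤s⁻¹; >-nonZero)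
open import Data.Nat.Logarithm using (⌈log₂_⌉; ⌈log₂⌉-mono-≤; ⌈log₂2*n⌉≡1+⌈log₂n⌉; ⌈log₂2^n⌉≡n)
import Data.Nat.Properties as ℕₚ
open import Data.Product using (Σ-syntax; _×_; _,_; proj₁; proj₂; ∃-syntax; map₂)
open import Data.Sum using (_⊎_; inj₁; inj₂; [_,_])
open import Data.Unit using (⊤; tt)
open import Function using (_∘_; flip; id)
open import Function.Definitions using (Injective)
open import Level using (0ℓ)
open import Relation.Binary.Bundles using (StrictTotalOrder; DecTotalOrder)
import Relation.Binary.Construct.StrictToNonStrict as ToNonStrict
open import Relation.Binary.Definitions using (Reflexive; Total; Transitive; tri<; tri≈; tri>)
open import Relation.Binary.PropositionalEquality using (_≡_; _≢_; refl; sym; trans; cong; subst; subst₂)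
import Relation.Binary.Reasoning.StrictPartialOrder as StrictReasoning
open import Relation.Nullary using (¬_; Dec; yes; no; does; contradiction)

-- The ordered field of reals

-- The upper bound is carried by `Chain`: from an admissible tuple in whatever order, pairwise
-- distances at least u give a chain of p - 1 gaps at least u into the last point of the front. An
-- output is therefore optimal once it is an ascending tuple with gaps at least v and every such
-- chain has u ≤ v; that v is attained follows by applying this bound to the output itself. Chains
-- may repeat points, so every position has a value in every row, namely 0 where too few points lie
-- to its left. For three or more points, strictness of the output is recovered afterwards: since p
-- ≤ n the optimum is positive, and a positive gap separates its endpoints. On the machine a single
-- constant is the exponent of the word bound, the time factor and the memory factor. Running times
-- are tracked as explicit step counts, through loop-free pieces and loops with a decreasing
-- variant, and their coefficients are left to unification.

module OrderedField (R : RealNumbers) where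
  open RealNumbers R

  private
    module C = CommutativeRing commutativeRing
    open RingProperties C.ring using (-‿distribˡ-*; -‿distribʳ-*; [y-z]x≈yx-zx)
    open RingProperties C.ring using () renaming (-‿involutive to involutive; -‿anti-homo-+ to anti)

    strictTotalOrder : StrictTotalOrder 0ℓ 0ℓ 0ℓ
    strictTotalOrder = record { isStrictTotalOrder = isStrictTotalOrder }

    decTotalOrder : DecTotalOrder 0ℓ 0ℓ 0ℓ
    decTotalOrder = record { isDecTotalOrder = ToNonStrict.isDecTotalOrder _≈_ _<ʳ_ isStrictTotalOrder }

  open StrictTotalOrder strictTotalOrder public
    using (strictPartialOrder)
    renaming (trans to <ʳ-trans; irrefl to <ʳ-irrefl)
  open DecTotalOrder decTotalOrder public
    using ()
    renaming ( refl to ≤ʳ-refl; trans to ≤ʳ-trans; antisym to ≤ʳ-antisym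
             ; total to ≤ʳ-total; reflexive to ≤ʳ-reflexive; _≤?_ to _≤ʳ?_)
  open C public using () renaming (refl to ≈-refl; reflexive to ≈-reflexive; sym to ≈-sym; trans to ≈-trans)
  open StrictReasoning strictPartialOrder

  <-≤ʳ-trans : ∀ {x y z} → x <ʳ y → y ≤ʳ z → x <ʳ z
  <-≤ʳ-trans {x} {y} {z} p q = begin-strict x <⟨ p ⟩ y ≤⟨ q ⟩ z ∎

  ≤-<ʳ-trans : ∀ {x y z} → x ≤ʳ y → y <ʳ z → x <ʳ z
  ≤-<ʳ-trans {x} {y} {z} p q = begin-strict x ≤⟨ p ⟩ y <⟨ q ⟩ z ∎

  ≮ʳ⇒≥ʳ : ∀ {x y} → ¬ (x <ʳ y) → y ≤ʳ x
  ≮ʳ⇒≥ʳ {x} {y} x≮y with compareʳ x y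
  ... | tri< x<y _ _ = contradiction x<y x≮y
  ... | tri≈ _ x≈y _ = inj₂ (≈-sym x≈y)
  ... | tri> _ _ y<x = inj₁ y<x

  ≤ʳ⇒≯ʳ : ∀ {x y} → x ≤ʳ y → ¬ (y <ʳ x)
  ≤ʳ⇒≯ʳ x≤y y<x = <ʳ-irrefl ≈-refl (≤-<ʳ-trans x≤y y<x)

  +-mono-≤ʳ : ∀ {w x y z} → w ≤ʳ x → y ≤ʳ z → w +ʳ y ≤ʳ x +ʳ z
  +-mono-≤ʳ {w} {x} {y} {z} w≤x y≤z = ≤ʳ-trans (shift y w≤x)
    (≤ʳ-trans (≤ʳ-reflexive (C.+-comm x y)) (≤ʳ-trans (shift x y≤z) (≤ʳ-reflexive (C.+-comm z x))))
    where
    shift : ∀ {a b} c → a ≤ʳ b → a +ʳ c ≤ʳ b +ʳ c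
    shift c (inj₁ a<b) = inj₁ (+-mono-< c a<b)
    shift c (inj₂ a≈b) = inj₂ (C.+-congʳ a≈b)

  x<y⇒0<y-x : ∀ {x y} → x <ʳ y → 0# <ʳ y -ʳ x
  x<y⇒0<y-x {x} {y} x<y = begin-strict
    0#      ≈⟨ C.-‿inverseʳ x ⟨
    x -ʳ x  <⟨ +-mono-< (C.- x) x<y ⟩
    y -ʳ x  ∎

  0<y-x⇒x<y : ∀ {x y} → 0# <ʳ y -ʳ x → x <ʳ y
  0<y-x⇒x<y {x} {y} 0<y-x = begin-strict
    x                   ≈⟨ C.+-identityˡ x ⟨
    0# +ʳ x             <⟨ +-mono-< x 0<y-x ⟩
    y -ʳ x +ʳ x         ≈⟨ C.+-assoc y (C.- x) x ⟩
    y +ʳ (C.- x +ʳ x)   ≈⟨ C.+-congˡ (C.-‿inverseˡ x) ⟩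
    y +ʳ 0#             ≈⟨ C.+-identityʳ y ⟩
    y                   ∎

  -‿swap : ∀ x y → C.- (x -ʳ y) ≈ y -ʳ x
  -‿swap x y = ≈-trans (anti x (C.- y)) (C.+-congʳ (involutive y))

  x≤y⇒0≤y-x : ∀ {x y} → x ≤ʳ y → 0# ≤ʳ y -ʳ x
  x≤y⇒0≤y-x     (inj₁ x<y) = inj₁ (x<y⇒0<y-x x<y)
  x≤y⇒0≤y-x {x} {y} (inj₂ x≈y) = inj₂ (≈-trans (≈-sym (C.-‿inverseʳ x)) (C.+-congʳ x≈y))

  -‿anti-≤ʳ : ∀ {x y} → x ≤ʳ y → C.- y ≤ʳ C.- x
  -‿anti-≤ʳ {x} {y} (inj₂ x≈y) = inj₂ (C.-‿cong (≈-sym x≈y))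
  -‿anti-≤ʳ {x} {y} (inj₁ x<y) = inj₁ (0<y-x⇒x<y (begin-strict
    0#                     <⟨ x<y⇒0<y-x x<y ⟩
    y -ʳ x                 ≈⟨ C.+-comm y (C.- x) ⟩
    C.- x +ʳ y             ≈⟨ C.+-congˡ (involutive y) ⟨
    C.- x -ʳ C.- y         ∎))

  *-monoʳ-<ʳ : ∀ {x y z} → 0# <ʳ z → x <ʳ y → x *ʳ z <ʳ y *ʳ z
  *-monoʳ-<ʳ {x} {y} {z} 0<z x<y = 0<y-x⇒x<y (begin-strict
    0#                  <⟨ *-pos (x<y⇒0<y-x x<y) 0<z ⟩
    (y -ʳ x) *ʳ z       ≈⟨ [y-z]x≈yx-zx z y x ⟩
    y *ʳ z -ʳ x *ʳ z    ∎)

  square-cong : ∀ {x y} → x ≈ y → x *ʳ x ≈ y *ʳ y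
  square-cong x≈y = C.*-cong x≈y x≈y

  square-mono-< : ∀ {x y} → 0# ≤ʳ x → x <ʳ y → x *ʳ x <ʳ y *ʳ y
  square-mono-< {x} {y} (inj₁ 0<x) x<y = begin-strict
    x *ʳ x  <⟨ *-monoʳ-<ʳ 0<x x<y ⟩
    y *ʳ x  ≈⟨ C.*-comm y x ⟩
    x *ʳ y  <⟨ *-monoʳ-<ʳ (<ʳ-trans 0<x x<y) x<y ⟩
    y *ʳ y  ∎
  square-mono-< {x} {y} (inj₂ 0≈x) x<y = begin-strict
    x *ʳ x    ≈⟨ C.*-congʳ 0≈x ⟨
    0# *ʳ x   ≈⟨ C.zeroˡ x ⟩
    0#        <⟨ *-pos 0<y 0<y ⟩
    y *ʳ y    ∎
    where 0<y = ≤-<ʳ-trans (inj₂ 0≈x) x<y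

  square-mono-≤ : ∀ {x y} → 0# ≤ʳ x → x ≤ʳ y → x *ʳ x ≤ʳ y *ʳ y
  square-mono-≤ 0≤x (inj₁ x<y) = inj₁ (square-mono-< 0≤x x<y)
  square-mono-≤ 0≤x (inj₂ x≈y) = inj₂ (square-cong x≈y)

  square-neg : ∀ x → (C.- x) *ʳ (C.- x) ≈ x *ʳ x
  square-neg x = ≈-trans (≈-sym (-‿distribˡ-* x (C.- x)))
    (≈-trans (C.-‿cong (≈-sym (-‿distribʳ-* x x))) (involutive (x *ʳ x)))

  square-swap : ∀ x y → (x -ʳ y) *ʳ (x -ʳ y) ≈ (y -ʳ x) *ʳ (y -ʳ x)
  square-swap x y = ≈-trans (≈-sym (square-neg (x -ʳ y))) (square-cong (-‿swap x y))

  square-nonneg : ∀ x → 0# ≤ʳ x *ʳ x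
  square-nonneg x with ≤ʳ-total 0# x
  ... | inj₁ 0≤x = ≤ʳ-trans (≤ʳ-reflexive (≈-sym (C.zeroˡ 0#))) (square-mono-≤ ≤ʳ-refl 0≤x)
  ... | inj₂ x≤0 = begin
    0#                  ≈⟨ C.zeroˡ 0# ⟨
    0# *ʳ 0#            ≤⟨ square-mono-≤ ≤ʳ-refl (≤ʳ-trans (≤ʳ-reflexive 0≈-0) (-‿anti-≤ʳ x≤0)) ⟩
    (C.- x) *ʳ (C.- x)  ≈⟨ square-neg x ⟩
    x *ʳ x              ∎
    where
    0≈-0 : 0# ≈ C.- 0#
    0≈-0 = ≈-trans (≈-sym (C.-‿inverseʳ 0#)) (C.+-identityˡ (C.- 0#))

  -- A strict inequality between the roots the other way round would survive squaring. Used in both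
  -- directions, this also makes distances respect `_≈_`.
  sqrt-mono-≤ : ∀ {x y} → 0# ≤ʳ x → x ≤ʳ y → sqrt x ≤ʳ sqrt y
  sqrt-mono-≤ {x} {y} 0≤x x≤y = ≮ʳ⇒≥ʳ λ √y<√x → ≤ʳ⇒≯ʳ x≤y (begin-strict
    y                   ≈⟨ sqrt-square 0≤y ⟨
    sqrt y *ʳ sqrt y    <⟨ square-mono-< (sqrt-nonneg 0≤y) √y<√x ⟩
    sqrt x *ʳ sqrt x    ≈⟨ sqrt-square 0≤x ⟩
    x                   ∎)
    where 0≤y = ≤ʳ-trans 0≤x x≤y

  sqrt-pos : ∀ {x} → 0# <ʳ x → 0# <ʳ sqrt x
  sqrt-pos {x} 0<x with sqrt-nonneg (inj₁ 0<x)
  ... | inj₁ 0<√x = 0<√x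
  ... | inj₂ 0≈√x = contradiction 0<x (<ʳ-irrefl (begin-equality
    0#                 ≈⟨ C.zeroˡ 0# ⟨
    0# *ʳ 0#           ≈⟨ square-cong 0≈√x ⟩
    sqrt x *ʳ sqrt x   ≈⟨ sqrt-square (inj₁ 0<x) ⟩
    x                  ∎))

  sqrt-zero : ∀ {x} → x ≈ 0# → sqrt x ≈ 0#
  sqrt-zero {x} x≈0 with sqrt-nonneg (inj₂ (≈-sym x≈0))
  ... | inj₂ 0≈√x = ≈-sym 0≈√x
  ... | inj₁ 0<√x = contradiction (*-pos 0<√x 0<√x)
    (<ʳ-irrefl (≈-sym (≈-trans (sqrt-square (inj₂ (≈-sym x≈0))) x≈0)))

  -- `^-mono-<` speaks of positive bases only; a zero base is covered by `0-^` and `^-pos`.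
  ^-mono-≤ : ∀ {x y a} → 0# <ʳ a → 0# ≤ʳ x → x ≤ʳ y → x ^ʳ a ≤ʳ y ^ʳ a
  ^-mono-≤ 0<a _          (inj₂ x≈y) = inj₂ (^-cong x≈y ≈-refl)
  ^-mono-≤ 0<a (inj₁ 0<x) (inj₁ x<y) = inj₁ (^-mono-< 0<a 0<x x<y)
  ^-mono-≤ {x} {y} {a} 0<a (inj₂ 0≈x) (inj₁ x<y) = begin
    x ^ʳ a    ≈⟨ ^-cong 0≈x ≈-refl ⟨
    0# ^ʳ a   ≈⟨ 0-^ 0<a ⟩
    0#        <⟨ ^-pos a (≤-<ʳ-trans (inj₂ 0≈x) x<y) ⟩
    y ^ʳ a    ∎

-- Distances along a front

module Geometry (R : RealNumbers) (α : RealNumbers.Carrier R)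
                (0<α : RealNumbers._<ʳ_ R (RealNumbers.0# R) α) where
  open RealNumbers R
  open Problem R α
  open OrderedField R
  private module C = CommutativeRing commutativeRing

  infix 4 _≼_

  _≼_ : Point → Point → Set
  (y¹ , y²) ≼ (z¹ , z²) = (y¹ ≤ʳ z¹) × (z² ≤ʳ y²)

  ≼-refl : ∀ {z} → z ≼ z
  ≼-refl = ≤ʳ-refl , ≤ʳ-refl

  ≼-trans : ∀ {w y z} → w ≼ y → y ≼ z → w ≼ z
  ≼-trans (p , q) (r , s) = ≤ʳ-trans p r , ≤ʳ-trans s q

  ≺⇒≼ : ∀ {y z} → y ≺ z → y ≼ z
  ≺⇒≼ (p , q) = inj₁ p , inj₁ q

  ≺⇒⋡ : ∀ {y z} → y ≺ z → ¬ (z ≼ y)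
  ≺⇒⋡ (y<z , _) (z≤y , _) = ≤ʳ⇒≯ʳ z≤y y<z

  ≺⇒≉ : ∀ {y z} → y ≺ z → ¬ (y ≈ₚ z)
  ≺⇒≉ (y<z , _) (y≈z , _) = <ʳ-irrefl y≈z y<z

  private
    norm² : Point → Point → Carrier
    norm² (y¹ , y²) (z¹ , z²) =
      (y¹ -ʳ z¹) *ʳ (y¹ -ʳ z¹) +ʳ (y² -ʳ z²) *ʳ (y² -ʳ z²)

    norm²-nonneg : ∀ y z → 0# ≤ʳ norm² y z
    norm²-nonneg y z = ≤ʳ-trans (≤ʳ-reflexive (≈-sym (C.+-identityˡ 0#)))
      (+-mono-≤ʳ (square-nonneg _) (square-nonneg _))

    dist^α-mono : ∀ {w x y z} → norm² w x ≤ʳ norm² y z → dist^α w x ≤ʳ dist^α y z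
    dist^α-mono {w} {x} le = ^-mono-≤ 0<α (sqrt-nonneg (norm²-nonneg w x)) (sqrt-mono-≤ (norm²-nonneg w x) le)

    gap-mono : ∀ {a b c d} → a ≤ʳ b → b ≤ʳ c → c ≤ʳ d → (c -ʳ b) *ʳ (c -ʳ b) ≤ʳ (d -ʳ a) *ʳ (d -ʳ a)
    gap-mono a≤b b≤c c≤d = square-mono-≤ (x≤y⇒0≤y-x b≤c) (+-mono-≤ʳ c≤d (-‿anti-≤ʳ a≤b))

  dist^α-cong : ∀ {w x y z} → w ≈ₚ x → y ≈ₚ z → dist^α w y ≈ dist^α x z
  dist^α-cong {w} {x} {y} {z} (p , q) (r , s) = ≤ʳ-antisym
    (dist^α-mono {w} {y} {x} {z} (≤ʳ-reflexive eq)) (dist^α-mono {x} {z} {w} {y} (≤ʳ-reflexive (≈-sym eq)))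
    where
    eq : norm² w y ≈ norm² x z
    eq = C.+-cong (square-cong (C.+-cong p (C.-‿cong r))) (square-cong (C.+-cong q (C.-‿cong s)))

  dist^α-sym : ∀ y z → dist^α y z ≈ dist^α z y
  dist^α-sym y z = ≤ʳ-antisym
    (dist^α-mono {y} {z} {z} {y} (≤ʳ-reflexive eq)) (dist^α-mono {z} {y} {y} {z} (≤ʳ-reflexive (≈-sym eq)))
    where
    eq : norm² y z ≈ norm² z y
    eq = C.+-cong (square-swap (proj₁ y) (proj₁ z)) (square-swap (proj₂ y) (proj₂ z))

  dist^α-diag : ∀ z → dist^α z z ≈ 0#
  dist^α-diag (z¹ , z²) = ≈-trans (^-cong (sqrt-zero zero²) ≈-refl) (0-^ 0<α)
    where
    square-zero : ∀ c → (c -ʳ c) *ʳ (c -ʳ c) ≈ 0#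
    square-zero c = ≈-trans (C.*-congʳ (C.-‿inverseʳ c)) (C.zeroˡ (c -ʳ c))
    zero² : norm² (z¹ , z²) (z¹ , z²) ≈ 0#
    zero² = ≈-trans (C.+-cong (square-zero z¹) (square-zero z²)) (C.+-identityˡ 0#)

  dist^α-pos : ∀ {y z} → y ≺ z → 0# <ʳ dist^α y z
  dist^α-pos {y} {z} (y<z , _) = ^-pos α (sqrt-pos (<-≤ʳ-trans
    (*-pos 0<z-y 0<z-y) (≤ʳ-trans (≤ʳ-reflexive (≈-sym (C.+-identityʳ _)))
    (+-mono-≤ʳ (≤ʳ-reflexive (square-swap (proj₁ z) (proj₁ y))) (square-nonneg _)))))
    where 0<z-y = x<y⇒0<y-x y<z

  -- Shrinking an interval of a front shrinks both coordinate differences.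
  dist^α-nested : ∀ {w x y z} → w ≼ x → x ≼ y → y ≼ z → dist^α x y ≤ʳ dist^α w z
  dist^α-nested {w} {x} {y} {z} (w≤x , x≥w) (x≤y , y≥x) (y≤z , z≥y) = dist^α-mono {x} {y} {w} {z} (+-mono-≤ʳ
    (≤ʳ-trans (≤ʳ-reflexive (square-swap (proj₁ x) (proj₁ y))) (≤ʳ-trans (gap-mono w≤x x≤y y≤z)
      (≤ʳ-reflexive (square-swap (proj₁ z) (proj₁ w)))))
    (gap-mono z≥y y≥x x≥w))

-- Paths along a front

-- Kept generic because it serves two orders: `_≤ʳ_` on gaps, and the reversed `_≼_`, where it finds
-- the last point of a selection.
argmin : {A : Set} {_≤_ : A → A → Set} → Total _≤_ → Reflexive _≤_ → Transitive _≤_ →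
         ∀ {m} (f : Fin (suc m) → A) → ∃[ i ] (∀ j → f i ≤ f j)
argmin tot rfl trn {zero} f = zero , λ { zero → rfl }
argmin tot rfl trn {suc m} f with argmin tot rfl trn (f ∘ suc)
... | i , min with tot (f zero) (f (suc i))
... | inj₁ le = zero , λ { zero → rfl ; (suc j) → trn le (min j) }
... | inj₂ ge = suc i , λ { zero → ge ; (suc j) → min j }

consecutive⇒pairwise : {A : Set} {_~_ : A → A → Set} → Transitive _~_ →
  ∀ {m} (f : Fin (suc m) → A) → (∀ i → f (inject₁ i) ~ f (suc i)) →
  ∀ i j → i Fin.< j → f i ~ f j
consecutive⇒pairwise _ {suc _} f step zero (suc zero) _ = step zero
consecutive⇒pairwise {_~_ = _~_} trn {suc (suc _)} f step zero (suc (suc j)) _ =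
  trn (step zero) (consecutive⇒pairwise {_~_ = _~_} trn (f ∘ suc) (step ∘ suc) zero (suc j) z<s)
consecutive⇒pairwise {_~_ = _~_} trn {suc _} f step (suc i) (suc j) (s<s i<j) =
  consecutive⇒pairwise {_~_ = _~_} trn (f ∘ suc) (step ∘ suc) i j i<j

module Chains (R : RealNumbers) (α : RealNumbers.Carrier R)
              (0<α : RealNumbers._<ʳ_ R (RealNumbers.0# R) α)
              {n : ℕ} (x : Fin n → Problem.Point R α)
              (pareto : Problem.IsParetoFront R α x) where
  open RealNumbers R
  open Problem R α
  open OrderedField R
  open Geometry R α 0<α

  -- Chain v k z: some points of the front, k in number and weakly ordered, lead
  -- up to z with all k gaps at least v.  Repetitions are harmless because they
  -- force v ≤ 0, while the optimum is positive.
  data Chain (v : Carrier) : ℕ → Point → Set where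
    start : ∀ {z} → Chain v 0 z
    step  : ∀ {k z} i → x i ≼ z → v ≤ʳ dist^α (x i) z → Chain v k (x i) → Chain v (suc k) z

  chain-weaken : ∀ {u v k z} → u ≤ʳ v → Chain v k z → Chain u k z
  chain-weaken u≤v start = start
  chain-weaken u≤v (step i i≼z v≤d c) = step i i≼z (≤ʳ-trans u≤v v≤d) (chain-weaken u≤v c)

  -- Moving the end to the right widens only the last gap.
  chain-extend : ∀ {v k y z} → y ≼ z → Chain v k y → Chain v k z
  chain-extend y≼z start = start
  chain-extend y≼z (step i i≼y v≤d c) =
    step i (≼-trans i≼y y≼z) (≤ʳ-trans v≤d (dist^α-nested ≼-refl i≼y y≼z)) c

  ≼-total : ∀ i j → x i ≼ x j ⊎ x j ≼ x i
  ≼-total i j with i Finₚ.≟ j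
  ... | yes refl = inj₁ ≼-refl
  ... | no  i≢j with pareto i j i≢j
  ...   | inj₁ i≺j = inj₁ (≺⇒≼ i≺j)
  ...   | inj₂ j≺i = inj₂ (≺⇒≼ j≺i)

  spread⇒chain : ∀ {v} k (ρ : Fin (suc k) → Fin n) →
    (∀ i j → i ≢ j → v ≤ʳ dist^α (x (ρ i)) (x (ρ j))) →
    ∃[ m ] (Chain v k (x (ρ m)) × (∀ i → x (ρ i) ≼ x (ρ m)))
  spread⇒chain k ρ gap
    with argmin {_≤_ = λ i j → x j ≼ x i} (flip ≼-total) ≼-refl (flip ≼-trans) ρ
  spread⇒chain zero    ρ gap | m , last = m , start , last
  spread⇒chain {v} (suc k) ρ gap | m , last
    with spread⇒chain {v} k (ρ ∘ punchIn m) (λ i j i≢j → gap _ _ (i≢j ∘ Finₚ.punchIn-injective m i j))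
  ... | m′ , c , _ = m , step _ (last _) (gap _ _ (Finₚ.punchInᵢ≢i m m′)) c , last

  -- The points of `z` are only `≈ₚ` to points of the front, so their distances are first
  -- transferred to the indices supplied by `inE`.
  dispersion⇒chain : ∀ {k} {z : Fin (suc k) → Point} {v top} → InD x z → IsDispersion z v →
    (∀ i → x i ≼ top) → Chain v k top
  dispersion⇒chain {k} {z} {v} (inE , _) (_ , least) top-max
    with spread⇒chain k (proj₁ ∘ inE) gap
    where
    moved : ∀ i j → dist^α (z i) (z j) ≤ʳ dist^α (x (proj₁ (inE i))) (x (proj₁ (inE j)))
    moved i j = ≤ʳ-reflexive (dist^α-cong (proj₂ (inE i)) (proj₂ (inE j)))
    gap : ∀ i j → i ≢ j → v ≤ʳ dist^α (x (proj₁ (inE i))) (x (proj₁ (inE j)))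
    gap i j i≢j with Finₚ.<-cmp i j
    ... | tri< i<j _ _ = ≤ʳ-trans (least _ (i , j , i<j , ≈-refl)) (moved i j)
    ... | tri≈ _ i≡j _ = contradiction i≡j i≢j
    ... | tri> _ _ j<i = ≤ʳ-trans (least _ (j , i , j<i , ≈-refl))
            (≤ʳ-trans (≤ʳ-reflexive (dist^α-sym _ _)) (moved i j))
  ... | _ , c , _ = chain-extend (top-max _) c

  -- `v` is assumed to be a mere lower bound of the gaps. The dispersion of `w` is its least gap, so
  -- `w` itself yields a chain for that gap, and `bound` shows the gap to be at most `v`; hence `v`
  -- is attained.
  certify : ∀ {k v top} (w : Fin (suc (suc k)) → Fin n) →
    (∀ i → x (w (inject₁ i)) ≺ x (w (suc i))) →
    (∀ i → v ≤ʳ dist^α (x (w (inject₁ i))) (x (w (suc i)))) →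
    (∀ i → x i ≼ top) → (∀ u → Chain u (suc k) top → u ≤ʳ v) →
    IsOptimalValue x (suc (suc k)) v × InD x (x ∘ w) × IsDispersion (x ∘ w) v
  certify {k} {v} {top} w ordered gap top-max bound =
    ((x ∘ w , w∈D , v-disp) , λ { u (z , z∈D , u-disp) → bound u (dispersion⇒chain z∈D u-disp top-max) })
    , w∈D , v-disp
    where
    ≺-trans : Transitive _≺_
    ≺-trans (p , q) (r , s) = <ʳ-trans p r , <ʳ-trans s q

    sorted : ∀ i j → i Fin.< j → x (w i) ≺ x (w j)
    sorted = consecutive⇒pairwise {_~_ = λ a b → x a ≺ x b} ≺-trans w ordered

    sorted≤ : ∀ i j → i Fin.≤ j → x (w i) ≼ x (w j)
    sorted≤ i j i≤j with i Finₚ.≟ j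
    ... | yes refl = ≼-refl
    ... | no i≢j   = ≺⇒≼ (sorted i j (Finₚ.≤∧≢⇒< i≤j i≢j))

    w∈D : InD x (x ∘ w)
    w∈D = (λ i → w i , ≈-refl , ≈-refl) , distinct
      where
      distinct : ∀ i j → i ≢ j → ¬ (x (w i) ≈ₚ x (w j))
      distinct i j i≢j eq with Finₚ.<-cmp i j
      ... | tri< i<j _ _ = ≺⇒≉ (sorted i j i<j) eq
      ... | tri≈ _ i≡j _ = i≢j i≡j
      ... | tri> _ _ j<i = ≺⇒≉ (sorted j i j<i) (≈-sym (proj₁ eq) , ≈-sym (proj₂ eq))

    gaps : Fin (suc k) → Carrier
    gaps i = dist^α (x (w (inject₁ i))) (x (w (suc i)))

    -- The interval from `i` to `j` contains the gap that ends at `j`.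
    gap-below : ∀ i j → i Fin.< j → ∃[ m ] (gaps m ≤ʳ dist^α (x (w i)) (x (w j)))
    gap-below i (suc j) i<j = j , dist^α-nested (sorted≤ i (inject₁ j) i≤j)
      (≺⇒≼ (ordered j)) ≼-refl
      where
      i≤j : i Fin.≤ inject₁ j
      i≤j rewrite Finₚ.toℕ-inject₁ j = s≤s⁻¹ i<j

    least-gap : ∃[ m ] (∀ j → gaps m ≤ʳ gaps j)
    least-gap = argmin ≤ʳ-total ≤ʳ-refl ≤ʳ-trans gaps

    m : Fin (suc k)
    m = proj₁ least-gap

    m-below : ∀ u → IsPairDistance (x ∘ w) u → gaps m ≤ʳ u
    m-below u (i , j , i<j , u≈d) with gap-below i j i<j
    ... | m′ , le = ≤ʳ-trans (proj₂ least-gap m′) (≤ʳ-trans le (≤ʳ-reflexive (≈-sym u≈d)))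

    m-pair : inject₁ m Fin.< suc m
    m-pair rewrite Finₚ.toℕ-inject₁ m = s≤s (Finₚ.≤-refl {x = m})

    v≈m : v ≈ gaps m
    v≈m = ≤ʳ-antisym (gap m) (bound _ (dispersion⇒chain w∈D
      ((inject₁ m , suc m , m-pair , ≈-refl) , m-below) top-max))

    v-disp : IsDispersion (x ∘ w) v
    v-disp = (inject₁ m , suc m , m-pair , v≈m) , λ u q → ≤ʳ-trans (≤ʳ-reflexive v≈m) (m-below u q)

-- A Hoare logic with running times

-- A write to a literal cell reduces by computation, a write at a variable index does not;
-- invariants handle the latter through this record.
record Updated {A : Set} (f : ℕ → A) (i : ℕ) (v : A) (g : ℕ → A) : Set where
  constructor updated
  field
    at-index  : g i ≡ v
    elsewhere : ∀ {j} → j ≢ i → g j ≡ f j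

update-spec : ∀ {k} {A : Set} (m : Fin k → ℕ → A) a i v → Updated (m a) i v (update m a i v a)
update-spec m a i v = updated same other
  where
  same : update m a i v a i ≡ v
  same with a Finₚ.≟ a | i ℕₚ.≟ i
  ... | yes _  | yes _  = refl
  ... | no a≢a | _      = contradiction refl a≢a
  ... | yes _  | no i≢i = contradiction refl i≢i
  other : ∀ {j} → j ≢ i → update m a i v a j ≡ m a j
  other {j} j≢i with a Finₚ.≟ a | i ℕₚ.≟ j
  ... | no _  | _       = refl
  ... | yes _ | no _    = refl
  ... | yes _ | yes i≡j = contradiction (sym i≡j) j≢i

does⇒ : {A : Set} (d : Dec A) → does d ≡ true → A
does⇒ (yes a) _ = a

does⇒¬ : {A : Set} (d : Dec A) → does d ≡ false → ¬ A
does⇒¬ (no ¬a) _ = ¬a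

-- Only meaningful for loop-free commands.
costᶜ : ∀ {k l} → Cmd k l → ℕ
costᶜ skip = 1
costᶜ (storeⁱ _ e f) = 1 + costⁱ e + costⁱ f
costᶜ (storeʳ _ e f) = 1 + costⁱ e + costʳ f
costᶜ (c ⨾ d) = costᶜ c + costᶜ d
costᶜ (ifᵇ b then c else d) = 1 + costᵇ b + (costᶜ c + costᶜ d)
costᶜ (while b loop c) = 0

-- The first summand pays for the failing test that ends the loop, the second for `m` rounds of test
-- and body.
while-time : ℕ → ℕ → ℕ → ℕ
while-time B K m = (1 + B) + m * (1 + B + K)

infix 4 _≤O[_]_

-- Being a record, it lets unification read off `c` from the way a bound is assembled, so that
-- coefficients can be left as `_`.
record _≤O[_]_ (T c N : ℕ) : Set where
  constructor bounded
  field
    bound : T ≤ c * N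

open _≤O[_]_ public

module OofN {N : ℕ} (1≤N : 1 ≤ N) where

  const-O : ∀ a → a ≤O[ a ] N
  const-O a = bounded (ℕₚ.≤-trans (ℕₚ.≤-reflexive (sym (ℕₚ.*-identityʳ a))) (ℕₚ.*-monoʳ-≤ a 1≤N))

  +-O : ∀ {T U c d} → T ≤O[ c ] N → U ≤O[ d ] N → T + U ≤O[ c + d ] N
  +-O {c = c} {d} T≤ U≤ = bounded (ℕₚ.≤-trans (ℕₚ.+-mono-≤ (bound T≤) (bound U≤))
    (ℕₚ.≤-reflexive (sym (ℕₚ.*-distribʳ-+ N c d))))

  while-O : ∀ B K m {e} → m ≤O[ e ] N → while-time B K m ≤O[ (1 + B) + e * (1 + B + K) ] N
  while-O B K m {e} m≤ = +-O (const-O (1 + B)) (bounded (begin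
    m * (1 + B + K)        ≤⟨ ℕₚ.*-monoˡ-≤ (1 + B + K) (bound m≤) ⟩
    e * N * (1 + B + K)    ≡⟨ ℕₚ.*-assoc e N _ ⟩
    e * (N * (1 + B + K))  ≡⟨ cong (e *_) (ℕₚ.*-comm N _) ⟩
    e * ((1 + B + K) * N)  ≡⟨ ℕₚ.*-assoc e _ N ⟨
    e * (1 + B + K) * N    ∎))
    where open ℕₚ.≤-Reasoning

≤O-refl : ∀ {N} → N ≤O[ 1 ] N
≤O-refl = bounded (ℕₚ.≤-reflexive (sym (ℕₚ.*-identityˡ _)))

module Hoare (R : RealNumbers) (α : RealNumbers.Carrier R) (W S p : ℕ) {n : ℕ}
             (x : Fin n → Problem.Point R α)
             (2≤W : 2 ≤ W) (n≤W : n ≤ W) (p≤W : p ≤ W) (0<S : 0 < S) where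
  open RealNumbers R
  open OrderedField R using (≮ʳ⇒≥ʳ)
  open Machine R α W S p x

  -- Weakest preconditions in continuation style: the obligations that always
  -- hold (small constants, cell 0 of an array) leave no trace.
  module _ {k l} (s : State k l) where

    okᵃ : IExp k → Set → Set
    okᵃ (const zero) K = K
    okᵃ e            K = evalⁱ s e < S × K

    okⁱ : IExp k → Set → Set
    okⁱ (const zero)                K = K
    okⁱ (const (suc zero))          K = K
    okⁱ (const (suc (suc zero)))    K = K
    -- Only `2 ≤ W` is known, and the programs contain no larger constant.
    okⁱ (const (suc (suc (suc m)))) K = ⊥
    okⁱ #points    K = K
    okⁱ #chosen    K = K
    okⁱ (load a e) K = okⁱ e (okᵃ e K)
    okⁱ (op o e f) K = okⁱ e (okⁱ f (definedⁱ o (evalⁱ s f) × evalⁱ s (op o e f) ≤ W × K))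

    okʳ : RExp k l → Set → Set
    okʳ zeroʳ      K = K
    okʳ oneʳ       K = K
    okʳ (load a e) K = okⁱ e (okᵃ e K)
    okʳ (coord₁ e) K = okⁱ e (evalⁱ s e < n × K)
    okʳ (coord₂ e) K = okⁱ e (evalⁱ s e < n × K)
    okʳ (op o e f) K = okʳ e (okʳ f (definedʳ o (evalʳ s f) × K))
    okʳ (distance^α a b c d) K = okʳ a (okʳ b (okʳ c (okʳ d K)))

    Holds : BExp k l → Bool → Set
    Holds (ltⁱ e f)  true  = evalⁱ s e < evalⁱ s f
    Holds (ltⁱ e f)  false = evalⁱ s f ≤ evalⁱ s e
    Holds (ltʳ e f)  true  = evalʳ s e <ʳ evalʳ s f
    Holds (ltʳ e f)  false = evalʳ s f ≤ʳ evalʳ s e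
    Holds (notᵇ b)   v     = Holds b (not v)
    Holds (andᵇ b c) true  = Holds b true × Holds c true
    Holds (andᵇ b c) false = Holds b false ⊎ Holds c false

    okᵇ : BExp k l → Set → Set
    okᵇ (ltⁱ e f)  K = okⁱ e (okⁱ f K)
    okᵇ (ltʳ e f)  K = okʳ e (okʳ f K)
    okᵇ (notᵇ b)   K = okᵇ b K
    -- `c` has to be safe only when `b` holds, while `K` must be available in either case; hence `K`
    -- stands outside the implication.
    okᵇ (andᵇ b c) K = okᵇ b ((Holds b true → okᵇ c ⊤) × K)

    okᵃ-sound : ∀ {K} e → okᵃ e K → evalⁱ s e < S × K
    okᵃ-sound (const zero)    q = 0<S , q
    okᵃ-sound (const (suc _)) q = q
    okᵃ-sound #points         q = q
    okᵃ-sound #chosen         q = q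
    okᵃ-sound (load _ _)      q = q
    okᵃ-sound (op _ _ _)      q = q

    okⁱ-sound : ∀ {K} e → okⁱ e K → safeⁱ s e × K
    okⁱ-sound (const zero)             q = z≤n , q
    okⁱ-sound (const (suc zero))       q = ℕₚ.<⇒≤ 2≤W , q
    okⁱ-sound (const (suc (suc zero))) q = 2≤W , q
    okⁱ-sound #points    q = n≤W , q
    okⁱ-sound #chosen    q = p≤W , q
    okⁱ-sound (load a e) q with okⁱ-sound e q
    ... | e-ok , q′ with okᵃ-sound e q′
    ...   | e<S , q″ = (e-ok , e<S) , q″
    okⁱ-sound (op o e f) q with okⁱ-sound e q
    ... | e-ok , q′ with okⁱ-sound f q′
    ...   | f-ok , def , ≤W , q″ = (e-ok , f-ok , def , ≤W) , q″

    okʳ-sound : ∀ {K} e → okʳ e K → safeʳ s e × K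
    okʳ-sound zeroʳ      q = tt , q
    okʳ-sound oneʳ       q = tt , q
    okʳ-sound (load a e) q with okⁱ-sound e q
    ... | e-ok , q′ with okᵃ-sound e q′
    ...   | e<S , q″ = (e-ok , e<S) , q″
    okʳ-sound (coord₁ e) q with okⁱ-sound e q
    ... | e-ok , e<n , q′ = (e-ok , e<n) , q′
    okʳ-sound (coord₂ e) q with okⁱ-sound e q
    ... | e-ok , e<n , q′ = (e-ok , e<n) , q′
    okʳ-sound (op o e f) q with okʳ-sound e q
    ... | e-ok , q′ with okʳ-sound f q′
    ...   | f-ok , def , q″ = (e-ok , f-ok , def) , q″
    okʳ-sound (distance^α a b c d) q with okʳ-sound a q
    ... | a-ok , q₁ with okʳ-sound b q₁
    ...   | b-ok , q₂ with okʳ-sound c q₂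
    ...     | c-ok , q₃ with okʳ-sound d q₃
    ...       | d-ok , q₄ = (a-ok , b-ok , c-ok , d-ok) , q₄

    eval⇒holds : ∀ b {v} → evalᵇ s b ≡ v → Holds b v
    eval⇒holds (ltⁱ e f) {true}  eq = does⇒ (evalⁱ s e <? evalⁱ s f) eq
    eval⇒holds (ltⁱ e f) {false} eq = ℕₚ.≮⇒≥ (does⇒¬ (evalⁱ s e <? evalⁱ s f) eq)
    eval⇒holds (ltʳ e f) {true}  eq = does⇒ (evalʳ s e <ʳ? evalʳ s f) eq
    eval⇒holds (ltʳ e f) {false} eq = ≮ʳ⇒≥ʳ (does⇒¬ (evalʳ s e <ʳ? evalʳ s f) eq)
    eval⇒holds (notᵇ b) {true}  eq with evalᵇ s b in eq′
    ... | false = eval⇒holds b eq′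
    eval⇒holds (notᵇ b) {false} eq with evalᵇ s b in eq′
    ... | true = eval⇒holds b eq′
    eval⇒holds (andᵇ b c) eq with evalᵇ s b in eq′
    eval⇒holds (andᵇ b c) {true}  eq | true  = eval⇒holds b eq′ , eval⇒holds c eq
    eval⇒holds (andᵇ b c) {false} eq | true  = inj₂ (eval⇒holds c eq)
    eval⇒holds (andᵇ b c) refl       | false = inj₁ (eval⇒holds b eq′)

    okᵇ-sound : ∀ {K} b → okᵇ b K → safeᵇ s b × K
    okᵇ-sound (ltⁱ e f) q with okⁱ-sound e q
    ... | e-ok , q′ with okⁱ-sound f q′
    ...   | f-ok , q″ = (e-ok , f-ok) , q″
    okᵇ-sound (ltʳ e f) q with okʳ-sound e q
    ... | e-ok , q′ with okʳ-sound f q′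
    ...   | f-ok , q″ = (e-ok , f-ok) , q″
    okᵇ-sound (notᵇ b) q = okᵇ-sound b q
    okᵇ-sound (andᵇ b c) q with okᵇ-sound b q
    ... | b-ok , c-ok , q′ = (b-ok , λ eq → proj₁ (okᵇ-sound c (c-ok (eval⇒holds b eq)))) , q′

  -- Loops are excluded here and left to `iterate`; a program is cut into loop-free pieces and
  -- loops, joined by `_⨟_`.
  wp : ∀ {k l} → Cmd k l → (State k l → Set) → State k l → Set
  wp skip Q s = Q s
  wp (storeⁱ a e f) Q s = okⁱ s e (okᵃ s e (okⁱ s f
    (Q ⟪ update (ints s) a (evalⁱ s e) (evalⁱ s f) , reals s ⟫)))
  wp (storeʳ a e f) Q s = okⁱ s e (okᵃ s e (okʳ s f
    (Q ⟪ ints s , update (reals s) a (evalⁱ s e) (evalʳ s f) ⟫)))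
  wp (c ⨾ d) Q s = wp c (wp d Q) s
  wp (ifᵇ b then c else d) Q s =
    okᵇ s b ((Holds s b true → wp c Q s) × (Holds s b false → wp d Q s))
  wp (while b loop c) Q s = ⊥

  Runs : ∀ {k l} → Cmd k l → State k l → ℕ → (State k l → Set) → Set
  Runs c s T Q = ∃[ t ] ∃[ s′ ] (⟨ c , s ⟩⇓⟨ t , s′ ⟩ × t ≤ T × Q s′)

  straight : ∀ {k l} (c : Cmd k l) {s Q} → wp c Q s → Runs c s (costᶜ c) Q
  straight skip q = _ , _ , skip , ℕₚ.≤-refl , q
  straight (storeⁱ a e f) {s} q with okⁱ-sound s e q
  ... | e-ok , q₁ with okᵃ-sound s e q₁
  ...   | e<S , q₂ with okⁱ-sound s f q₂
  ...     | f-ok , q₃ = _ , _ , storeⁱ e-ok e<S f-ok , ℕₚ.≤-refl , q₃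
  straight (storeʳ a e f) {s} q with okⁱ-sound s e q
  ... | e-ok , q₁ with okᵃ-sound s e q₁
  ...   | e<S , q₂ with okʳ-sound s f q₂
  ...     | f-ok , q₃ = _ , _ , storeʳ e-ok e<S f-ok , ℕₚ.≤-refl , q₃
  straight (c ⨾ d) q with straight c q
  ... | _ , _ , c-run , t≤ , q′ with straight d q′
  ...   | _ , _ , d-run , u≤ , q″ = _ , _ , c-run ⨾ d-run , ℕₚ.+-mono-≤ t≤ u≤ , q″
  straight (ifᵇ b then c else d) {s} q with okᵇ-sound s b q
  ... | b-ok , on-true , on-false with evalᵇ s b in eq
  ...   | true with straight c (on-true (eval⇒holds s b eq))
  ...     | _ , _ , run , t≤ , q′ = _ , _ , if-true b-ok eq run ,
            ℕₚ.+-monoʳ-≤ (1 + costᵇ b) (ℕₚ.≤-trans t≤ (ℕₚ.m≤m+n _ _)) , q′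
  straight (ifᵇ b then c else d) {s} q | b-ok , on-true , on-false | false
    with straight d (on-false (eval⇒holds s b eq))
  ... | _ , _ , run , t≤ , q′ = _ , _ , if-false b-ok eq run ,
        ℕₚ.+-monoʳ-≤ (1 + costᵇ b) (ℕₚ.≤-trans t≤ (ℕₚ.m≤n+m _ _)) , q′

  infixr 5 _⨟_

  _⨟_ : ∀ {k l} {c d : Cmd k l} {s T U P Q} →
        Runs c s T P → (∀ {s′} → P s′ → Runs d s′ U Q) → Runs (c ⨾ d) s (T + U) Q
  (_ , _ , c-run , t≤ , q) ⨟ k with k q
  ... | _ , _ , d-run , u≤ , q′ = _ , _ , c-run ⨾ d-run , ℕₚ.+-mono-≤ t≤ u≤ , q′

  relax : ∀ {k l} {c : Cmd k l} {s T U P Q} → T ≤ U → (∀ {s′} → P s′ → Q s′) →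
          Runs c s T P → Runs c s U Q
  relax T≤U P⇒Q (_ , _ , run , t≤ , q) = _ , _ , run , ℕₚ.≤-trans t≤ T≤U , P⇒Q q

  -- The variant `fuel` is at most `m` on entry and drops in every round, so there are at most `m`
  -- rounds, each with a body of cost at most `K`.
  iterate : ∀ {k l} {b} {c : Cmd k l} (I : State k l → Set) (fuel : State k l → ℕ) (K : ℕ) →
    (∀ {s} → I s → okᵇ s b ⊤) →
    (∀ {s} → I s → Holds s b true → Runs c s K (λ s′ → I s′ × fuel s′ < fuel s)) →
    ∀ {s} m → fuel s ≤ m → I s →
    Runs (while b loop c) s (while-time (costᵇ b) K m) (λ s′ → I s′ × Holds s′ b false)
  iterate {b = b} I fuel K ok body {s} m f≤m i with proj₁ (okᵇ-sound s b (ok i)) | evalᵇ s b in eq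
  ... | b-ok | false = _ , _ , while-false b-ok eq , ℕₚ.m≤m+n _ _ , i , eval⇒holds s b eq
  ... | b-ok | true with body i (eval⇒holds s b eq)
  iterate {b = b} I fuel K ok body zero f≤m i | b-ok | true | _ , _ , _ , _ , _ , less
    = contradiction (ℕₚ.<-≤-trans less f≤m) λ ()
  iterate {b = b} I fuel K ok body (suc m) f≤m i | b-ok | true | t , s′ , run , t≤ , i′ , less
    with iterate {b = b} I fuel K ok body {s′} m (s≤s⁻¹ (ℕₚ.<-≤-trans less f≤m)) i′
  ... | u , s″ , run′ , u≤ , q = _ , s″ , while-true b-ok eq run run′ , time , q
    where
    B = costᵇ b
    open ℕₚ.≤-Reasoning
    time : 1 + B + t + u ≤ while-time B K (suc m)
    time = begin
      1 + B + t + u                                       ≤⟨ ℕₚ.+-mono-≤ (ℕₚ.+-monoʳ-≤ (1 + B) t≤) u≤ ⟩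
      1 + B + K + ((1 + B) + m * (1 + B + K))             ≡⟨ ℕₚ.+-comm (1 + B + K) _ ⟩
      (1 + B) + m * (1 + B + K) + (1 + B + K)             ≡⟨ ℕₚ.+-assoc (1 + B) _ _ ⟩
      (1 + B) + (m * (1 + B + K) + (1 + B + K))           ≡⟨ cong ((1 + B) +_) (ℕₚ.+-comm (m * (1 + B + K)) _) ⟩
      (1 + B) + (1 + B + K + m * (1 + B + K))             ∎

-- Input points and their extremes

infix 8 !_

!_ : ∀ {k} → Fin k → IExp k
! a = load a (const 0)

infixl 7 _⊕_
_⊕_ : ∀ {k} → IExp k → IExp k → IExp k
_⊕_ = op plus

infix 6 _:=_ _[_]:=_ _[_]:=ʳ_

_:=_ : ∀ {k l} → Fin k → IExp k → Cmd k l
a := e = storeⁱ a (const 0) e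

_[_]:=_ : ∀ {k l} → Fin k → IExp k → IExp k → Cmd k l
a [ e ]:= f = storeⁱ a e f

_[_]:=ʳ_ : ∀ {k l} → Fin l → IExp k → RExp k l → Cmd k l
a [ e ]:=ʳ f = storeʳ a e f

distance : ∀ {k l} → IExp k → IExp k → RExp k l
distance a b = distance^α (coord₁ a) (coord₂ a) (coord₁ b) (coord₂ b)

pattern #0 = Fin.zero
pattern #1 = Fin.suc #0
pattern #2 = Fin.suc #1
pattern #3 = Fin.suc #2
pattern #4 = Fin.suc #3
pattern #5 = Fin.suc #4
pattern #6 = Fin.suc #5
pattern #7 = Fin.suc #6
pattern #8 = Fin.suc #7
pattern #9 = Fin.suc #8

<1+-elim : ∀ {k} (P : ℕ → Set) → (∀ m → m < k → P m) → P k → ∀ m → m < suc k → P m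
<1+-elim {k} P below at m m<1+k with ℕₚ.m<1+n⇒m<n∨m≡n m<1+k
... | inj₁ m<k  = below m m<k
... | inj₂ refl = at

module Points (R : RealNumbers) (α : RealNumbers.Carrier R)
              (0<α : RealNumbers._<ʳ_ R (RealNumbers.0# R) α)
              (W S p : ℕ) {n : ℕ} (x : Fin n → Problem.Point R α)
              (pareto : Problem.IsParetoFront R α x) where
  open RealNumbers R
  open Problem R α
  open OrderedField R
  open Geometry R α 0<α
  open Chains R α 0<α x pareto
  open Machine R α W S p x using (inputPoint)

  abscissa : ℕ → Carrier
  abscissa m = proj₁ (inputPoint m)

  gap : ℕ → ℕ → Carrier
  gap a b = dist^α (inputPoint a) (inputPoint b)

  inputPoint-fromℕ< : ∀ {m} (m<n : m < n) → inputPoint m ≡ x (fromℕ< m<n)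
  inputPoint-fromℕ< {m} m<n with m <? n
  ... | yes _  = refl
  ... | no m≮n = contradiction m<n m≮n

  inputPoint-toℕ : ∀ i → inputPoint (toℕ i) ≡ x i
  inputPoint-toℕ i = trans (inputPoint-fromℕ< (Finₚ.toℕ<n i)) (cong x (Finₚ.fromℕ<-toℕ i _))

  comparable : ∀ {a b} → a < n → b < n → a ≢ b → inputPoint a 𝓘 inputPoint b
  comparable a<n b<n a≢b rewrite inputPoint-fromℕ< a<n | inputPoint-fromℕ< b<n =
    pareto _ _ λ eq → a≢b (Finₚ.fromℕ<-injective _ _ a<n b<n eq)

  -- Distinct points of a front are comparable, so the abscissas alone decide the direction. This is
  -- why the programs never compare ordinates.
  abscissa-≤⇒≺ : ∀ {a b} → a < n → b < n → a ≢ b → abscissa a ≤ʳ abscissa b → inputPoint a ≺ inputPoint b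
  abscissa-≤⇒≺ a<n b<n a≢b a≤b with comparable a<n b<n a≢b
  ... | inj₁ a≺b = a≺b
  ... | inj₂ b≺a = contradiction (proj₁ b≺a) (≤ʳ⇒≯ʳ a≤b)

  abscissa-≤⇒≼ : ∀ {a b} → a < n → b < n → abscissa a ≤ʳ abscissa b → inputPoint a ≼ inputPoint b
  abscissa-≤⇒≼ {a} {b} a<n b<n a≤b with a ℕₚ.≟ b
  ... | yes refl = ≼-refl
  ... | no a≢b   = ≺⇒≼ (abscissa-≤⇒≺ a<n b<n a≢b a≤b)

  ≼x : ∀ {z} → (∀ m → m < n → inputPoint m ≼ z) → ∀ i → x i ≼ z
  ≼x {z} all i = subst (_≼ z) (inputPoint-toℕ i) (all (toℕ i) (Finₚ.toℕ<n i))

  record Ordered (a : ℕ → ℕ) : Set where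
    field
      index<n : ∀ m → m < n → a m < n
      ascends : ∀ l m → l < m → m < n → inputPoint (a l) ≺ inputPoint (a m)

-- Integer arrays: 0 output, 1 cursor, 2 leftmost and 3 rightmost point so far.
scan scan-min scan-max : ∀ {l} → Cmd 5 l
scan-min = ifᵇ ltʳ (coord₁ (! #1)) (coord₁ (! #2)) then #2 := ! #1 else skip
scan-max = ifᵇ ltʳ (coord₁ (! #3)) (coord₁ (! #1)) then #3 := ! #1 else skip
scan = #1 := const 0 ⨾ #2 := const 0 ⨾ #3 := const 0 ⨾
  while ltⁱ (! #1) #points loop (scan-min ⨾ scan-max ⨾ #1 := ! #1 ⊕ const 1)

scan-step : ℕ → ℕ
scan-step l = costᶜ {5} {l} (scan-min ⨾ scan-max ⨾ #1 := ! #1 ⊕ const 1)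

-- Here 3 is the cost of assigning a constant to a cell and 4 that of the loop test.
scan-time : ℕ → ℕ → ℕ
scan-time l n = 3 + (3 + (3 + while-time 4 (scan-step l) n))

module Scan (R : RealNumbers) (α : RealNumbers.Carrier R)
            (0<α : RealNumbers._<ʳ_ R (RealNumbers.0# R) α)
            (W S p : ℕ) {n : ℕ} (x : Fin n → Problem.Point R α)
            (pareto : Problem.IsParetoFront R α x)
            (2≤W : 2 ≤ W) (n≤W : n ≤ W) (p≤W : p ≤ W) (0<S : 0 < S) (2≤n : 2 ≤ n) where
  open RealNumbers R
  open Problem R α
  open OrderedField R
  open Geometry R α 0<α
  open Machine R α W S p x
  open Hoare R α W S p x 2≤W n≤W p≤W 0<S
  open Points R α 0<α W S p x pareto

  -- The two bounds are separate because the minimum is updated before the maximum: in between, `lo`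
  -- already accounts for the cursor and `hi` does not.
  record Scanned (kˡ kʰ lo hi : ℕ) : Set where
    field
      lo<n  : lo < n
      hi<n  : hi < n
      least : ∀ m → m < kˡ → abscissa lo ≤ʳ abscissa m
      most  : ∀ m → m < kʰ → abscissa m ≤ʳ abscissa hi

  record Extremes (lo hi : ℕ) : Set where
    field
      lo<n  : lo < n
      hi<n  : hi < n
      lo≢hi : lo ≢ hi
      lo≼   : ∀ m → m < n → inputPoint lo ≼ inputPoint m
      ≼hi   : ∀ m → m < n → inputPoint m ≼ inputPoint hi
    lo≺hi : inputPoint lo ≺ inputPoint hi
    lo≺hi = abscissa-≤⇒≺ lo<n hi<n lo≢hi (proj₁ (lo≼ hi hi<n))

  scanned⇒extremes : ∀ {k lo hi} → n ≤ k → Scanned k k lo hi → Extremes lo hi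
  scanned⇒extremes {k} {lo} {hi} n≤k sc = record
    { lo<n = lo<n ; hi<n = hi<n
    -- If the extremes coincided, all abscissas would agree, in particular those of points 0 and 1,
    -- which are comparable.
    ; lo≢hi = λ { refl → apart (≤ʳ-antisym
        (≤ʳ-trans (most 0 (0<k)) (least 1 1<k)) (≤ʳ-trans (most 1 1<k) (least 0 0<k))) }
    ; lo≼ = λ m m<n → abscissa-≤⇒≼ lo<n m<n (least m (ℕₚ.<-≤-trans m<n n≤k))
    ; ≼hi = λ m m<n → abscissa-≤⇒≼ m<n hi<n (most m (ℕₚ.<-≤-trans m<n n≤k)) }
    where
    open Scanned sc
    1<k : 1 < k
    1<k = ℕₚ.<-≤-trans 2≤n n≤k
    0<k : 0 < k
    0<k = ℕₚ.<⇒≤ 1<k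
    apart : ¬ (abscissa 0 ≈ abscissa 1)
    apart eq with comparable (ℕₚ.<⇒≤ 2≤n) 2≤n (λ ())
    ... | inj₁ 0≺1 = <ʳ-irrefl eq (proj₁ 0≺1)
    ... | inj₂ 1≺0 = <ʳ-irrefl (≈-sym eq) (proj₁ 1≺0)

  scan-runs : ∀ {l} {s : State 5 l} →
    Runs scan s (scan-time l n) (λ s′ → Extremes (ints s′ #2 0) (ints s′ #3 0))
  scan-runs {l} = straight _ {Q = λ s → ints s #1 0 ≡ 0} refl ⨟
    λ k≡0 → straight _ {Q = λ s → ints s #1 0 ≡ 0 × ints s #2 0 ≡ 0} (k≡0 , refl) ⨟
    λ (k≡0 , lo≡0) → straight _ {Q = Inv} (init k≡0 lo≡0) ⨟
    λ {s′} i → relax ℕₚ.≤-refl (λ ((_ , sc) , n≤k) → scanned⇒extremes n≤k sc)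
      (iterate Inv (λ s → n ∸ ints s #1 0) (scan-step l) _ body n (ℕₚ.m∸n≤m n (ints s′ #1 0)) i)
    where
    Inv : State 5 l → Set
    Inv s = ints s #1 0 ≤ n × Scanned (ints s #1 0) (ints s #1 0) (ints s #2 0) (ints s #3 0)

    init : ∀ {k lo} → k ≡ 0 → lo ≡ 0 → k ≤ n × Scanned k k lo 0
    init refl refl = z≤n , record
      { lo<n = ℕₚ.<⇒≤ 2≤n ; hi<n = ℕₚ.<⇒≤ 2≤n ; least = λ _ () ; most = λ _ () }

    body : ∀ {s} → Inv s → ints s #1 0 < n →
      Runs (scan-min ⨾ scan-max ⨾ #1 := ! #1 ⊕ const 1) s (scan-step l)
        (λ s′ → Inv s′ × n ∸ ints s′ #1 0 < n ∸ ints s #1 0)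
    body {s} (_ , sc) k<n =
      straight scan-min {Q = λ s′ → ints s′ #1 0 ≡ k × Scanned (suc k) k (ints s′ #2 0) (ints s′ #3 0)}
        (k<n , lo<n ,
         (λ k<lo → refl , record { lo<n = k<n ; hi<n = hi<n ; most = most
            ; least = <1+-elim _ (λ m m<k → ≤ʳ-trans (inj₁ k<lo) (least m m<k)) ≤ʳ-refl }) ,
         (λ lo≤k → refl , record { lo<n = lo<n ; hi<n = hi<n ; most = most
            ; least = <1+-elim _ least lo≤k })) ⨟
      λ { {s′} (k≡ , sc′) → straight (scan-max ⨾ #1 := ! #1 ⊕ const 1) (second {s′} k≡ sc′) }
      where
      open Scanned sc
      k = ints s #1 0
      second : ∀ {s′} → ints s′ #1 0 ≡ k → Scanned (suc k) k (ints s′ #2 0) (ints s′ #3 0) →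
        wp (scan-max ⨾ #1 := ! #1 ⊕ const 1) (λ s′ → Inv s′ × n ∸ ints s′ #1 0 < n ∸ k) s′
      second {s′} k≡ sc′ rewrite k≡ | ℕₚ.+-comm k 1 = sc.hi<n , k<n ,
        (λ hi<k → _ , ℕₚ.≤-trans k<n n≤W , (k<n , record { lo<n = sc.lo<n ; hi<n = k<n ; least = sc.least
            ; most = <1+-elim _ (λ m m<k → ≤ʳ-trans (sc.most m m<k) (inj₁ hi<k)) ≤ʳ-refl })
          , ℕₚ.∸-monoʳ-< ℕₚ.≤-refl k<n) ,
        (λ k≤hi → _ , ℕₚ.≤-trans k<n n≤W , (k<n , record { lo<n = sc.lo<n ; hi<n = sc.hi<n ; least = sc.least
            ; most = <1+-elim _ sc.most k≤hi })
          , ℕₚ.∸-monoʳ-< ℕₚ.≤-refl k<n)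
        where module sc = Scanned sc′

-- Two points

module Certificates (R : RealNumbers) (α : RealNumbers.Carrier R)
              (0<α : RealNumbers._<ʳ_ R (RealNumbers.0# R) α)
              (W S p : ℕ) {n : ℕ} (x : Fin n → Problem.Point R α)
              (pareto : Problem.IsParetoFront R α x) where
  open RealNumbers R
  open Problem R α
  open OrderedField R
  open Geometry R α 0<α
  open Chains R α 0<α x pareto
  open Machine R α W S p x using (inputPoint)
  open Points R α 0<α W S p x pareto

  certify-array : ∀ {k v top} (a : ℕ → ℕ) →
    (∀ m → m < suc (suc k) → a m < n) →
    (∀ m → suc m < suc (suc k) → inputPoint (a m) ≺ inputPoint (a (suc m))) →
    (∀ m → suc m < suc (suc k) → v ≤ʳ gap (a m) (a (suc m))) →
    (∀ m → m < n → inputPoint m ≼ top) →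
    (∀ u → Chain u (suc k) top → u ≤ʳ v) →
    IsOptimalValue x (suc (suc k)) v ×
      Σ[ σ ∈ (Fin (suc (suc k)) → Fin n) ] (∀ i → a (toℕ i) ≡ toℕ (σ i)) ×
        InD x (λ i → x (σ i)) × IsDispersion (λ i → x (σ i)) v
  certify-array {k} {v} a a<n ordered gaps top-max upper =
    proj₁ certified , σ , (λ i → sym (Finₚ.toℕ-fromℕ< (a<n _ (Finₚ.toℕ<n i)))) , proj₂ certified
    where
    σ : Fin (suc (suc k)) → Fin n
    σ i = fromℕ< (a<n (toℕ i) (Finₚ.toℕ<n i))
    at : ∀ i → inputPoint (a (toℕ i)) ≡ x (σ i)
    at i = inputPoint-fromℕ< (a<n (toℕ i) (Finₚ.toℕ<n i))
    at₁ : ∀ i → inputPoint (a (toℕ i)) ≡ x (σ (inject₁ i))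
    at₁ i = trans (cong (inputPoint ∘ a) (sym (Finₚ.toℕ-inject₁ i))) (at (inject₁ i))
    certified : IsOptimalValue x (suc (suc k)) v × InD x (x ∘ σ) × IsDispersion (x ∘ σ) v
    certified = certify σ
      (λ i → subst₂ _≺_ (at₁ i) (at (suc i)) (ordered (toℕ i) (s≤s (Finₚ.toℕ<n i))))
      (λ i → subst₂ (λ y z → v ≤ʳ dist^α y z) (at₁ i) (at (suc i)) (gaps (toℕ i) (s≤s (Finₚ.toℕ<n i))))
      (≼x top-max) upper

power-≥ : ∀ {n} j c → 1 ≤ n → n ^ j ≤ n ^ (j + c)
power-≥ {suc _} j c _ = ℕₚ.^-monoʳ-≤ _ (ℕₚ.m≤m+n j c)

n≤n^1+c : ∀ {n} c → 1 ≤ n → n ≤ n ^ suc c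
n≤n^1+c {n} c 1≤n = ℕₚ.≤-trans (ℕₚ.≤-reflexive (sym (ℕₚ.*-identityʳ n))) (power-≥ 1 c 1≤n)

-- Abstract, so that the large constants are never unfolded.
abstract
  scan-linear : ∀ l → ∃[ c ] (∀ {n} → 1 ≤ n → scan-time l n ≤O[ c ] n)
  scan-linear l = _ , λ {n} 1≤n → let open OofN 1≤n in
    +-O (const-O 3) (+-O (const-O 3) (+-O (const-O 3) (while-O 4 (scan-step l) n ≤O-refl)))

report-pair : Cmd 5 1
report-pair = #0 [ const 0 ]:= ! #2 ⨾ #0 [ const 1 ]:= ! #3 ⨾ #0 [ const 0 ]:=ʳ distance (! #2) (! #3)

extreme-pair : Program
extreme-pair = record { k = 4 ; l = 0 ; code = scan ⨾ report-pair }

pair-time : ℕ → ℕ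
pair-time n = scan-time 1 n + costᶜ report-pair

abstract
  pair-linear : ∃[ c ] (∀ {n} → 1 ≤ n → pair-time n ≤O[ c ] n)
  pair-linear = _ , λ 1≤n → let open OofN 1≤n in
    +-O (proj₂ (scan-linear 1) 1≤n) (const-O (costᶜ report-pair))

module Pair (R : RealNumbers) (α : RealNumbers.Carrier R)
            (0<α : RealNumbers._<ʳ_ R (RealNumbers.0# R) α) where
  open RealNumbers R
  open Problem R α
  open OrderedField R
  open Geometry R α 0<α
  open Complexity R α

  -- The memory 18 is five integer arrays and one real array of three cells each.
  runs : ∀ W → 2 ≤ W → ∀ {n} (n≤W : n ≤ W) (x : Fin n → Point) → IsParetoFront x → 2 ≤ n →
    SolvesWithin extreme-pair W (pair-time n) 18 2 x
  runs W 2≤W {n} n≤W x pareto 2≤n = 3 , ℕₚ.≤-refl ,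
      scan-runs {l = 1} ⨟ λ e → relax ℕₚ.≤-refl (λ {s′} → output s′)
        (straight report-pair {Q = Reported}
          (s≤s (s≤s z≤n) , Extremes.lo<n e , Extremes.lo<n e , Extremes.hi<n e , Extremes.hi<n e , (_ , _ , e , refl , refl , refl)))
    where
    open Machine R α W 3 2 x
    open Hoare R α W 3 2 x 2≤W n≤W 2≤W (s≤s z≤n)
    open Points R α 0<α W 3 2 x pareto
    open Certificates R α 0<α W 3 2 x pareto
    open Scan R α 0<α W 3 2 x pareto 2≤W n≤W 2≤W (s≤s z≤n) 2≤n
    open Chains R α 0<α x pareto

    Reported : State 5 1 → Set
    Reported s = ∃[ lo ] ∃[ hi ] (Extremes lo hi ×
      ints s #0 0 ≡ lo × ints s #0 1 ≡ hi × reals s #0 0 ≡ gap lo hi)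

    output : ∀ s → Reported s → Output s
    output s (_ , _ , e , refl , refl , v≡) = s≤s (s≤s z≤n) , certify-array {0} (ints s #0)
      (λ { 0 _ → lo<n ; 1 _ → hi<n ; (suc (suc _)) (s≤s (s≤s ())) })
      (λ { 0 _ → lo≺hi ; (suc _) (s≤s (s≤s ())) })
      (λ { 0 _ → ≤ʳ-reflexive (≈-reflexive v≡) ; (suc _) (s≤s (s≤s ())) }) ≼hi upper
      where
      open Extremes e
      upper : ∀ u → Chain u 1 (inputPoint (ints s #0 1)) → u ≤ʳ reals s #0 0
      upper u (step i i≼hi u≤d start) = ≤ʳ-trans u≤d (≤ʳ-trans (dist^α-nested
        (subst (inputPoint (ints s #0 0) ≼_) (inputPoint-toℕ i) (lo≼ (toℕ i) (Finₚ.toℕ<n i))) i≼hi ≼-refl)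
        (≤ʳ-reflexive (≈-reflexive (sym v≡))))

-- Three points

-- Integer array 4 holds the best middle point so far; real arrays: 0 its value,
-- 1 the value of the point at the cursor.
candidate keep-best advance search report-triple : Cmd 5 2
candidate = ifᵇ ltʳ (distance (! #2) (! #1)) (distance (! #1) (! #3))
  then #1 [ const 0 ]:=ʳ distance (! #2) (! #1)
  else (#1 [ const 0 ]:=ʳ distance (! #1) (! #3))
keep-best = ifᵇ ltʳ (load #0 (const 0)) (load #1 (const 0))
  then #0 [ const 0 ]:=ʳ load #1 (const 0) ⨾ #4 := ! #1
  else skip
advance = #1 := ! #1 ⊕ const 1
search = #0 [ const 0 ]:=ʳ zeroʳ ⨾ #1 := const 0 ⨾
  while ltⁱ (! #1) #points loop (candidate ⨾ keep-best ⨾ advance)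
report-triple = #0 [ const 0 ]:= ! #2 ⨾ #0 [ const 1 ]:= ! #4 ⨾ #0 [ const 2 ]:= ! #3

best-middle : Program
best-middle = record { k = 4 ; l = 1 ; code = scan ⨾ search ⨾ report-triple }

search-time : ℕ → ℕ
search-time n = 3 + (3 + while-time 4 (costᶜ (candidate ⨾ keep-best ⨾ advance)) n)

triple-time : ℕ → ℕ
triple-time n = scan-time 2 n + (search-time n + costᶜ report-triple)

abstract
  triple-linear : ∃[ c ] (∀ {n} → 1 ≤ n → triple-time n ≤O[ c ] n)
  triple-linear = _ , λ {n} 1≤n → let open OofN 1≤n in
    +-O (proj₂ (scan-linear 2) 1≤n)
        (+-O (+-O (const-O 3) (+-O (const-O 3) (while-O 4 _ n ≤O-refl))) (const-O (costᶜ report-triple)))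

-- With at least three input points, some point is neither extreme; as a middle point it shows the
-- optimum to be positive.
third-index : ∀ a b → ∃[ m ] (m < 3 × m ≢ a × m ≢ b)
third-index zero          (suc zero)    = 2 , s≤s (s≤s (s≤s z≤n)) , (λ ()) , (λ ())
third-index zero          zero          = 1 , s≤s (s≤s z≤n) , (λ ()) , (λ ())
third-index zero          (suc (suc _)) = 1 , s≤s (s≤s z≤n) , (λ ()) , (λ ())
third-index (suc zero)    zero          = 2 , s≤s (s≤s (s≤s z≤n)) , (λ ()) , (λ ())
third-index (suc (suc _)) zero          = 1 , s≤s (s≤s z≤n) , (λ ()) , (λ ())
third-index (suc _)       (suc _)       = 0 , s≤s z≤n , (λ ()) , (λ ())

module Triple (R : RealNumbers) (α : RealNumbers.Carrier R)
              (0<α : RealNumbers._<ʳ_ R (RealNumbers.0# R) α) where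
  open RealNumbers R
  open Problem R α
  open OrderedField R
  open Geometry R α 0<α
  open Complexity R α

  -- The memory 21 is five integer and two real arrays of three cells each.
  runs : ∀ W → 3 ≤ W → ∀ {n} (n≤W : n ≤ W) (x : Fin n → Point) → IsParetoFront x → 3 ≤ n →
    SolvesWithin best-middle W (triple-time n) 21 3 x
  runs W 3≤W {n} n≤W x pareto 3≤n = 3 , ℕₚ.≤-refl ,
    (scan-runs {l = 2} ⨟ λ e → searching e ⨟ λ (e , found) →
      relax ℕₚ.≤-refl (λ {s′} → output s′)
        (straight report-triple {Q = Reported}
          (s≤s (s≤s z≤n) , s≤s (s≤s (s≤s z≤n)) , (_ , _ , _ , e , found , refl , refl , refl))))
    where
    2≤W : 2 ≤ W
    2≤W = ℕₚ.<⇒≤ 3≤W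
    2≤n : 2 ≤ n
    2≤n = ℕₚ.<⇒≤ 3≤n
    open Machine R α W 3 3 x
    open Hoare R α W 3 3 x 2≤W n≤W 3≤W (s≤s z≤n)
    open Points R α 0<α W 3 3 x pareto
    open Certificates R α 0<α W 3 3 x pareto
    open Scan R α 0<α W 3 3 x pareto 2≤W n≤W 3≤W (s≤s z≤n) 2≤n
    open Chains R α 0<α x pareto

    -- The search starts from the value 0 with a meaningless `mid`, so `attained` is promised only
    -- once the value is positive.
    record Searched (k lo hi mid : ℕ) (best : Carrier) : Set where
      field
        nonneg   : 0# ≤ʳ best
        attained : 0# <ʳ best → mid < n × best ≤ʳ gap lo mid × best ≤ʳ gap mid hi
        maximal  : ∀ m → m < k → ∀ u → u ≤ʳ gap lo m → u ≤ʳ gap m hi → u ≤ʳ best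

    Inv : State 5 2 → Set
    Inv s = Extremes (ints s #2 0) (ints s #3 0) × ints s #1 0 ≤ n ×
      Searched (ints s #1 0) (ints s #2 0) (ints s #3 0) (ints s #4 0) (reals s #0 0)

    -- The minimum of two reals, given by its universal property.
    Meet : Carrier → Carrier → Carrier → Set
    Meet a b c = c ≤ʳ a × c ≤ʳ b × (∀ u → u ≤ʳ a → u ≤ʳ b → u ≤ʳ c)

    body : ∀ {s} → Inv s → ints s #1 0 < n →
      Runs (candidate ⨾ keep-best ⨾ advance) s (costᶜ (candidate ⨾ keep-best ⨾ advance))
        (λ s′ → Inv s′ × n ∸ ints s′ #1 0 < n ∸ ints s #1 0)
    body {s} (e , k≤n , se) k<n =
      straight candidate {Q = λ s′ → Inv s′ × ints s′ #1 0 ≡ ints s #1 0 ×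
          Meet (gap (ints s′ #2 0) (ints s′ #1 0)) (gap (ints s′ #1 0) (ints s′ #3 0)) (reals s′ #1 0)}
        (lo<n , lo<n , k<n , k<n , k<n , k<n , hi<n , hi<n ,
         (λ lt → lo<n , lo<n , k<n , k<n , (e , k≤n , se) , refl , ≤ʳ-refl , inj₁ lt , λ u p _ → p) ,
         (λ ge → k<n , k<n , hi<n , hi<n , (e , k≤n , se) , refl , ge , ≤ʳ-refl , λ u _ q → q)) ⨟
      λ { {s′} (inv , k≡ , meet) → straight (keep-best ⨾ advance) (keep {s′} inv k≡ meet) }
      where
      open Extremes e
      keep : ∀ {s′} → Inv s′ → ints s′ #1 0 ≡ ints s #1 0 →
        Meet (gap (ints s′ #2 0) (ints s′ #1 0)) (gap (ints s′ #1 0) (ints s′ #3 0)) (reals s′ #1 0) →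
        wp (keep-best ⨾ advance) (λ s″ → Inv s″ × n ∸ ints s″ #1 0 < n ∸ ints s #1 0) s′
      keep {s′} (e′ , _ , se′) k≡ (l≤ , r≤ , glb) =
        (λ better → _ , 1+k≤W , (e′ , 1+k≤n , record
            { nonneg = ≤ʳ-trans S′.nonneg (inj₁ better)
            ; attained = λ _ → k<n′ , l≤ , r≤
            ; maximal = extend λ u → <1+-elim _
                (λ m m<k p q → ≤ʳ-trans (S′.maximal m m<k u p q) (inj₁ better)) (glb u) })
          , less) ,
        (λ worse → _ , 1+k≤W , (e′ , 1+k≤n , record
            { nonneg = S′.nonneg ; attained = S′.attained
            ; maximal = extend λ u → <1+-elim _ (λ m m<k → S′.maximal m m<k u)
                (λ p q → ≤ʳ-trans (glb u p q) worse) })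
          , less)
        where
        module S′ = Searched se′
        k = ints s′ #1 0
        k<n′ : k < n
        k<n′ = subst (_< n) (sym k≡) k<n
        1+k≤n : k + 1 ≤ n
        1+k≤n = subst (_≤ n) (ℕₚ.+-comm 1 k) k<n′
        1+k≤W : k + 1 ≤ W
        1+k≤W = ℕₚ.≤-trans 1+k≤n n≤W
        less : n ∸ (k + 1) < n ∸ ints s #1 0
        less = ℕₚ.∸-monoʳ-< (ℕₚ.≤-reflexive (trans (cong suc (sym k≡)) (ℕₚ.+-comm 1 k))) 1+k≤n
        extend : {P : ℕ → Carrier → Set} → (∀ u m → m < suc k → P m u) → ∀ m → m < k + 1 → ∀ u → P m u
        extend f m m<k+1 u = f u m (subst (m <_) (ℕₚ.+-comm k 1) m<k+1)

    searching : ∀ {s} → Extremes (ints s #2 0) (ints s #3 0) → Runs search s (search-time n) (λ s′ →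
      Extremes (ints s′ #2 0) (ints s′ #3 0) ×
      Searched n (ints s′ #2 0) (ints s′ #3 0) (ints s′ #4 0) (reals s′ #0 0))
    searching e = straight _ {Q = λ s → Extremes (ints s #2 0) (ints s #3 0) × reals s #0 0 ≡ 0#} (e , refl) ⨟
      λ (e , z) → straight _ {Q = Inv} (e , z≤n , start-search z) ⨟
      λ {s} i → relax ℕₚ.≤-refl (λ ((e , k≤n , se) , n≤k) → e , all n≤k se)
        (iterate Inv (λ s → n ∸ ints s #1 0) _ _ body n (ℕₚ.m∸n≤m n (ints s #1 0)) i)
      where
      start-search : ∀ {lo hi mid v} → v ≡ 0# → Searched 0 lo hi mid v
      start-search refl = record { nonneg = ≤ʳ-refl ; attained = λ lt → contradiction lt (<ʳ-irrefl ≈-refl) ; maximal = λ _ () }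
      all : ∀ {k lo hi mid v} → n ≤ k → Searched k lo hi mid v → Searched n lo hi mid v
      all n≤k se = record { nonneg = nonneg ; attained = attained ; maximal = λ m m<n → maximal m (ℕₚ.<-≤-trans m<n n≤k) }
        where open Searched se

    Reported : State 5 2 → Set
    Reported s = ∃[ lo ] ∃[ hi ] ∃[ mid ] (Extremes lo hi × Searched n lo hi mid (reals s #0 0) ×
      ints s #0 0 ≡ lo × ints s #0 1 ≡ mid × ints s #0 2 ≡ hi)

    output : ∀ s → Reported s → Output s
    output s (_ , _ , _ , e , se , refl , refl , refl) = ℕₚ.≤-refl , certify-array {1} (ints s #0)
      (λ { 0 _ → lo<n ; 1 _ → mid<n ; 2 _ → hi<n ; (suc (suc (suc _))) (s≤s (s≤s (s≤s ()))) })
      (λ { 0 _ → abscissa-≤⇒≺ lo<n mid<n lo≢mid (proj₁ (lo≼ mid mid<n))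
         ; 1 _ → abscissa-≤⇒≺ mid<n hi<n mid≢hi (proj₁ (≼hi mid mid<n)) ; (suc (suc _)) (s≤s (s≤s (s≤s ()))) })
      (λ { 0 _ → proj₁ (proj₂ att) ; 1 _ → proj₂ (proj₂ att) ; (suc (suc _)) (s≤s (s≤s (s≤s ()))) })
      ≼hi upper
      where
      open Extremes e
      open Searched se
      lo = ints s #0 0
      mid = ints s #0 1
      hi = ints s #0 2
      best = reals s #0 0

      positive : ∀ m → m < n → m ≢ lo → m ≢ hi → 0# <ʳ best
      positive m m<n m≢lo m≢hi with ≤ʳ-total (gap lo m) (gap m hi)
      ... | inj₁ le = <-≤ʳ-trans (dist^α-pos (abscissa-≤⇒≺ lo<n m<n (m≢lo ∘ sym) (proj₁ (lo≼ m m<n))))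
                        (maximal m m<n _ ≤ʳ-refl le)
      ... | inj₂ ge = <-≤ʳ-trans (dist^α-pos (abscissa-≤⇒≺ m<n hi<n m≢hi (proj₁ (≼hi m m<n))))
                        (maximal m m<n _ ge ≤ʳ-refl)

      0<best : 0# <ʳ best
      0<best with third-index lo hi
      ... | m , m<3 , m≢lo , m≢hi = positive m (ℕₚ.<-≤-trans m<3 3≤n) m≢lo m≢hi
      att : mid < n × best ≤ʳ gap lo mid × best ≤ʳ gap mid hi
      att = attained 0<best
      mid<n : mid < n
      mid<n = proj₁ att

      -- The search may visit the extremes themselves; a positive value rules them out, because the
      -- gap from a point to itself is 0.
      separated : ∀ {a b} → 0# <ʳ gap a b → a ≢ b
      separated pos refl = <ʳ-irrefl (≈-sym (dist^α-diag _)) pos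
      lo≢mid : lo ≢ mid
      lo≢mid = separated (<-≤ʳ-trans 0<best (proj₁ (proj₂ att)))
      mid≢hi : mid ≢ hi
      mid≢hi = separated (<-≤ʳ-trans 0<best (proj₂ (proj₂ att)))

      -- Replacing the first point of the chain by `lo` only widens its first gap.
      upper : ∀ u → Chain u 2 (inputPoint hi) → u ≤ʳ best
      upper u (step i i≼hi u≤r (step j j≼i u≤l start)) = maximal (toℕ i) (Finₚ.toℕ<n i) u
        (≤ʳ-trans u≤l (≤ʳ-trans (dist^α-nested (lo≼x j) j≼i ≼-refl) (≤ʳ-reflexive (≈-reflexive
          (cong (dist^α (inputPoint lo)) (sym (inputPoint-toℕ i)))))))
        (subst (λ z → u ≤ʳ dist^α z (inputPoint hi)) (sym (inputPoint-toℕ i)) u≤r)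
        where
        lo≼x : ∀ i → inputPoint lo ≼ x i
        lo≼x i = subst (inputPoint lo ≼_) (inputPoint-toℕ i) (lo≼ (toℕ i) (Finₚ.toℕ<n i))

-- Merge sort

module Merge (R : RealNumbers) (α : RealNumbers.Carrier R)
             (0<α : RealNumbers._<ʳ_ R (RealNumbers.0# R) α)
             (W S p : ℕ) {n : ℕ} (x : Fin n → Problem.Point R α)
             (pareto : Problem.IsParetoFront R α x) where
  open RealNumbers R
  open Problem R α
  open OrderedField R
  open Points R α 0<α W S p x pareto

  infix 4 _⊏_
  _⊏_ : ℕ → ℕ → Set
  a ⊏ b = abscissa a <ʳ abscissa b

  -- Entries stay within their block, hence those of different blocks are distinct
  -- and the sort needs no separate permutation invariant.
  record SortedOn (a : ℕ → ℕ) (lo hi : ℕ) : Set where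
    field
      inside : ∀ c → lo ≤ c → c < hi → c < n → lo ≤ a c × a c < hi × a c < n
      rising : ∀ c d → lo ≤ c → c < d → d < hi → d < n → a c ⊏ a d

  sortedOn-resp : ∀ {a b lo hi} → (∀ c → c < hi → c < n → b c ≡ a c) → SortedOn a lo hi → SortedOn b lo hi
  sortedOn-resp {a} {b} eq s = record
    { inside = λ c lo≤c c<hi c<n → subst (λ v → _ ≤ v × v < _ × v < n) (sym (eq c c<hi c<n)) (inside c lo≤c c<hi c<n)
    ; rising = λ c d lo≤c c<d d<hi d<n → subst₂ _⊏_ (sym (eq c (ℕₚ.<-trans c<d d<hi) (ℕₚ.<-trans c<d d<n)))
        (sym (eq d d<hi d<n)) (rising c d lo≤c c<d d<hi d<n) }
    where open SortedOn s

  BlockSorted : ℕ → (ℕ → ℕ) → Set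
  BlockSorted w a = ∀ q → SortedOn a (q * w) (q * w + w)

  identity-sorted : ∀ {a} → (∀ m → m < n → a m ≡ m) → BlockSorted 1 a
  identity-sorted {a} eq q = sortedOn-resp {a = id} (λ c _ → eq c) record
    { inside = λ c lo≤c c<hi c<n → lo≤c , c<hi , c<n
    ; rising = λ c d lo≤c c<d d<hi _ → contradiction (ℕₚ.≤-<-trans lo≤c c<d)
        (ℕₚ.≤⇒≯ (s≤s⁻¹ (subst (d <_) (ℕₚ.+-comm (q * 1) 1) d<hi))) }

  -- Blocks `q + q` and `suc (q + q)` of width `w` are the halves of block `q` of width `w + w`.
  double : ∀ q w → (q + q) * w ≡ q * (w + w)
  double q w = trans (ℕₚ.*-distribʳ-+ w q q) (sym (ℕₚ.*-distribˡ-+ q w w))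

  left-half : ∀ {w a} → BlockSorted w a → ∀ q → SortedOn a (q * (w + w)) (q * (w + w) + w)
  left-half {w} {a} s q = subst (λ lo → SortedOn a lo (lo + w)) (double q w) (s (q + q))

  right-half : ∀ {w a} → BlockSorted w a → ∀ q → SortedOn a (q * (w + w) + w) (q * (w + w) + w + w)
  right-half {w} {a} s q = subst (λ lo → SortedOn a lo (lo + w))
    (trans (ℕₚ.+-comm w _) (cong (_+ w) (double q w))) (s (suc (q + q)))

  -- `Rest` holds the input positions not yet emitted. `below` is what keeps `ordered` true when a
  -- least remaining entry is appended.
  record Merging (lo hi k : ℕ) (a b : ℕ → ℕ) (Rest : ℕ → Set) : Set where
    field
      range   : ∀ c → lo ≤ c → c < k → lo ≤ b c × b c < hi × b c < n
      ordered : ∀ c d → lo ≤ c → c < d → d < k → b c ⊏ b d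
      below   : ∀ c e → lo ≤ c → c < k → Rest e → e < n → b c ⊏ a e

  start-merging : ∀ {lo hi a b Rest} → Merging lo hi lo a b Rest
  start-merging = record
    { range   = λ c lo≤c c<lo → contradiction c<lo (ℕₚ.≤⇒≯ lo≤c)
    ; ordered = λ c d lo≤c c<d d<lo → contradiction (ℕₚ.<-trans c<d d<lo) (ℕₚ.≤⇒≯ lo≤c)
    ; below   = λ c e lo≤c c<lo → contradiction c<lo (ℕₚ.≤⇒≯ lo≤c) }

  finish-merging : ∀ {lo hi k a b Rest} → (∀ c → c < hi → c < n → c < k) →
    Merging lo hi k a b Rest → SortedOn b lo hi
  finish-merging <k m = record
    { inside = λ c lo≤c c<hi c<n → range c lo≤c (<k c c<hi c<n)
    ; rising = λ c d lo≤c c<d d<hi d<n → ordered c d lo≤c c<d (<k d d<hi d<n) }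
    where open Merging m

  emit-merging : ∀ {lo hi k a b b′ Rest Rest′ e₀} → Merging lo hi k a b Rest →
    Updated b k (a e₀) b′ → Rest e₀ → e₀ < n → lo ≤ a e₀ × a e₀ < hi × a e₀ < n →
    (∀ e → Rest′ e → e < n → Rest e × a e₀ ⊏ a e) →
    Merging lo hi (suc k) a b′ Rest′
  emit-merging {lo} {hi} {k} {a} {b} {b′} {Rest} {Rest′} {e₀} m up e₀∈ e₀<n ins least = record
    { range   = λ c lo≤c c<1+k → <1+-elim (λ c → lo ≤ c → lo ≤ b′ c × b′ c < hi × b′ c < n)
        (λ c c<k lo≤c → subst (λ v → lo ≤ v × v < hi × v < n) (sym (old c<k)) (range c lo≤c c<k))
        (λ _ → subst (λ v → lo ≤ v × v < hi × v < n) (sym at-index) ins) c c<1+k lo≤c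
    ; ordered = λ c d lo≤c c<d d<1+k → <1+-elim (λ d → c < d → b′ c ⊏ b′ d)
        (λ d d<k c<d → subst₂ _⊏_ (sym (old (ℕₚ.<-trans c<d d<k))) (sym (old d<k)) (ordered c d lo≤c c<d d<k))
        (λ c<k → subst₂ _⊏_ (sym (old c<k)) (sym at-index) (below c e₀ lo≤c c<k e₀∈ e₀<n)) d d<1+k c<d
    ; below   = λ c e lo≤c c<1+k e∈ e<n → <1+-elim (λ c → lo ≤ c → b′ c ⊏ a e)
        (λ c c<k lo≤c → subst (_⊏ a e) (sym (old c<k)) (below c e lo≤c c<k (proj₁ (least e e∈ e<n)) e<n))
        (λ _ → subst (_⊏ a e) (sym at-index) (proj₂ (least e e∈ e<n))) c c<1+k lo≤c }
    where
    open Merging m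
    open Updated up
    old : ∀ {c} → c < k → b′ c ≡ b c
    old c<k = elsewhere (ℕₚ.<⇒≢ c<k)

  Remaining : (i mid j hi : ℕ) → ℕ → Set
  Remaining i mid j hi e = (i ≤ e × e < mid) ⊎ (j ≤ e × e < hi)

  -- `count` is (i - lo) + (j - mid) = k - lo, written without subtraction.
  record MergeState (w k i j mid hi : ℕ) (a b : ℕ → ℕ) : Set where
    constructor mergeState
    field
      q    : ℕ
      mid≡ : mid ≡ q * (w + w) + w
      hi≡  : hi ≡ mid + w
    lo : ℕ
    lo = q * (w + w)
    field
      lo≤k  : lo ≤ k
      k≤hi  : k ≤ hi
      k≤n   : k ≤ n
      lo≤i  : lo ≤ i
      i≤mid : i ≤ mid
      mid≤j : mid ≤ j
      j≤hi  : j ≤ hi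
      count : i + j ≡ k + mid
      done  : ∀ q′ → q′ < q → SortedOn b (q′ * (w + w)) (q′ * (w + w) + (w + w))
      cur   : Merging lo hi k a b (Remaining i mid j hi)

    i≤k : i ≤ k
    i≤k = ℕₚ.+-cancelʳ-≤ mid i k (ℕₚ.≤-trans (ℕₚ.+-monoʳ-≤ i mid≤j) (ℕₚ.≤-reflexive count))

    -- Used with `B` equal to `hi` and to `n`: when the right half is used up, or cut off by the end
    -- of the input, the next entry must come from the left half.
    room-left : ∀ {B} → k < B → B ≤ j → i < mid
    room-left {B} k<B B≤j = ℕₚ.+-cancelʳ-< B i mid (begin-strict
      i + B    ≤⟨ ℕₚ.+-monoʳ-≤ i B≤j ⟩
      i + j    ≡⟨ count ⟩
      k + mid  <⟨ ℕₚ.+-monoˡ-< mid k<B ⟩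
      B + mid  ≡⟨ ℕₚ.+-comm B mid ⟩
      mid + B  ∎)
      where open ℕₚ.≤-Reasoning

  module _ {w k i j mid hi a b} (M : MergeState w k i j mid hi a b) (s : BlockSorted w a) (k<hi : k < hi) (k<n : k < n) where
    open MergeState M

    private
      left : SortedOn a lo mid
      left = subst (SortedOn a lo) (sym mid≡) (left-half s q)
      right : SortedOn a mid hi
      right = subst₂ (SortedOn a) (sym mid≡) (sym (trans hi≡ (cong (_+ w) mid≡))) (right-half s q)
      module Left  = SortedOn left
      module Right = SortedOn right

      lo≤mid : lo ≤ mid
      lo≤mid = ℕₚ.≤-trans lo≤i i≤mid
      mid≤hi : mid ≤ hi
      mid≤hi = ℕₚ.≤-trans mid≤j j≤hi

      at-or-after : ∀ {u v lo′ hi′} → SortedOn a lo′ hi′ → lo′ ≤ u → u ≤ v → v < hi′ → v < n → abscissa (a u) ≤ʳ abscissa (a v)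
      at-or-after {u} {v} so lo≤u u≤v v<hi v<n with ℕₚ.m≤n⇒m<n∨m≡n u≤v
      ... | inj₁ u<v  = inj₁ (SortedOn.rising so u v lo≤u u<v v<hi v<n)
      ... | inj₂ refl = ≤ʳ-refl

      done′ : ∀ {v b′} → Updated b k v b′ → ∀ q′ → q′ < q → SortedOn b′ (q′ * (w + w)) (q′ * (w + w) + (w + w))
      done′ up q′ q′<q = sortedOn-resp (λ c c<end _ → Updated.elsewhere up (ℕₚ.<⇒≢ (ℕₚ.<-≤-trans c<end
        (ℕₚ.≤-trans (ℕₚ.≤-trans (ℕₚ.≤-reflexive (ℕₚ.+-comm (q′ * (w + w)) (w + w))) (ℕₚ.*-monoˡ-≤ (w + w) q′<q)) lo≤k))))
        (done q′ q′<q)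

    i<n : i < n
    i<n = ℕₚ.≤-<-trans i≤k k<n

    left-inside : i < mid → lo ≤ a i × a i < mid × a i < n
    left-inside i<mid = Left.inside i lo≤i i<mid i<n

    right-inside : j < hi → j < n → mid ≤ a j × a j < hi × a j < n
    right-inside j<hi j<n = Right.inside j mid≤j j<hi j<n

    -- The alternatives of `why` are what a failing guard of `merge-emit` provides.
    emit-left : ∀ {b′} → hi ≤ j ⊎ n ≤ j ⊎ (i < mid × a i ⊏ a j) → Updated b k (a i) b′ →
      MergeState w (suc k) (suc i) j mid hi a b′
    emit-left {b′} why up = mergeState q mid≡ hi≡ (ℕₚ.m≤n⇒m≤1+n lo≤k) k<hi k<n (ℕₚ.m≤n⇒m≤1+n lo≤i) i<mid mid≤j j≤hi
      (cong suc count) (done′ up)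
      (emit-merging cur up (inj₁ (ℕₚ.≤-refl , i<mid)) i<n
        (proj₁ ins , ℕₚ.<-≤-trans (proj₁ (proj₂ ins)) mid≤hi , proj₂ (proj₂ ins)) least)
      where
      i<mid : i < mid
      i<mid = [ room-left k<hi , [ room-left k<n , proj₁ ] ] why
      ins : lo ≤ a i × a i < mid × a i < n
      ins = left-inside i<mid
      least : ∀ e → Remaining (suc i) mid j hi e → e < n → Remaining i mid j hi e × a i ⊏ a e
      least e (inj₁ (i<e , e<mid)) e<n = inj₁ (ℕₚ.<⇒≤ i<e , e<mid) , Left.rising i e lo≤i i<e e<mid e<n
      least e (inj₂ (j≤e , e<hi)) e<n = inj₂ (j≤e , e<hi) , first why
        where
        first : hi ≤ j ⊎ n ≤ j ⊎ (i < mid × a i ⊏ a j) → a i ⊏ a e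
        first (inj₁ hi≤j) = contradiction e<hi (ℕₚ.≤⇒≯ (ℕₚ.≤-trans hi≤j j≤e))
        first (inj₂ (inj₁ n≤j)) = contradiction e<n (ℕₚ.≤⇒≯ (ℕₚ.≤-trans n≤j j≤e))
        first (inj₂ (inj₂ (_ , lt))) = <-≤ʳ-trans lt (at-or-after right mid≤j j≤e e<hi e<n)

    emit-right : ∀ {b′} → j < hi → j < n → mid ≤ i ⊎ abscissa (a j) ≤ʳ abscissa (a i) → Updated b k (a j) b′ →
      MergeState w (suc k) i (suc j) mid hi a b′
    emit-right {b′} j<hi j<n why up = mergeState q mid≡ hi≡ (ℕₚ.m≤n⇒m≤1+n lo≤k) k<hi k<n lo≤i i≤mid (ℕₚ.m≤n⇒m≤1+n mid≤j) j<hi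
      (trans (ℕₚ.+-suc i j) (cong suc count)) (done′ up)
      (emit-merging cur up (inj₂ (ℕₚ.≤-refl , j<hi)) j<n
        (ℕₚ.≤-trans lo≤mid (proj₁ ins) , proj₂ ins) least)
      where
      ins : mid ≤ a j × a j < hi × a j < n
      ins = right-inside j<hi j<n
      least : ∀ e → Remaining i mid (suc j) hi e → e < n → Remaining i mid j hi e × a j ⊏ a e
      least e (inj₂ (j<e , e<hi)) e<n = inj₂ (ℕₚ.<⇒≤ j<e , e<hi) , Right.rising j e mid≤j j<e e<hi e<n
      least e (inj₁ (i≤e , e<mid)) e<n = inj₁ (i≤e , e<mid) , first why
        where
        i<mid : i < mid
        i<mid = ℕₚ.≤-<-trans i≤e e<mid
        first : mid ≤ i ⊎ abscissa (a j) ≤ʳ abscissa (a i) → a j ⊏ a e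
        first (inj₁ mid≤i) = contradiction i<mid (ℕₚ.≤⇒≯ mid≤i)
        -- The comparison is only weak, but the two entries lie on different sides of `mid`, so they
        -- are distinct points and their abscissas differ strictly.
        first (inj₂ le) = <-≤ʳ-trans (proj₁ (abscissa-≤⇒≺ (proj₂ (proj₂ ins)) (proj₂ (proj₂ (left-inside i<mid)))
          (ℕₚ.>⇒≢ (ℕₚ.<-≤-trans (proj₁ (proj₂ (left-inside i<mid))) (proj₁ ins))) le))
          (at-or-after left lo≤i i≤e e<mid e<n)

  first-block : ∀ {w a b} → MergeState w 0 0 w w (w + w) a b
  first-block {w} = mergeState 0 refl refl z≤n z≤n z≤n z≤n z≤n ℕₚ.≤-refl (ℕₚ.m≤m+n w w) refl (λ _ ()) start-merging

  next-block : ∀ {w k i j mid hi a b} → MergeState w k i j mid hi a b → hi ≤ k →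
    MergeState w k k (k + w) (k + w) (k + w + w) a b
  next-block {w} {k} {mid = mid} {hi} {a} {b} M hi≤k = mergeState (suc q) (cong (_+ w) k≡) refl
    (ℕₚ.≤-reflexive (sym k≡)) (ℕₚ.≤-trans (ℕₚ.m≤m+n k w) (ℕₚ.m≤m+n (k + w) w)) k≤n
    (ℕₚ.≤-reflexive (sym k≡)) (ℕₚ.m≤m+n k w) ℕₚ.≤-refl (ℕₚ.m≤m+n (k + w) w) refl
    (λ q′ q′<1+q → <1+-elim (λ q′ → SortedOn b (q′ * (w + w)) (q′ * (w + w) + (w + w))) done
      (subst (SortedOn b lo) hi≡lo (finish-merging (λ c c<hi _ → ℕₚ.<-≤-trans c<hi hi≤k) cur)) q′ q′<1+q)
    (subst (λ l → Merging l (k + w + w) k a b (Remaining k (k + w) (k + w) (k + w + w))) k≡ start-merging)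
    where
    open MergeState M
    hi≡lo : hi ≡ lo + (w + w)
    hi≡lo = trans hi≡ (trans (cong (_+ w) mid≡) (ℕₚ.+-assoc lo w w))
    k≡ : k ≡ suc q * (w + w)
    k≡ = trans (ℕₚ.≤-antisym k≤hi hi≤k) (trans hi≡lo (ℕₚ.+-comm lo (w + w)))

  -- Output may stop in the middle of block `q`. Earlier blocks are done, block `q` is complete up
  -- to the end of the input, and later blocks begin beyond it.
  all-merged : ∀ {w k i j mid hi a b} → MergeState w k i j mid hi a b → n ≤ k → BlockSorted (w + w) b
  all-merged {w} {k} {hi = hi} {b = b} M n≤k q′ with ℕₚ.<-cmp q′ q
    where open MergeState M
  ... | tri< q′<q _ _ = MergeState.done M q′ q′<q
  ... | tri≈ _ refl _ = subst (SortedOn b lo) (trans hi≡ (trans (cong (_+ w) mid≡) (ℕₚ.+-assoc lo w w)))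
          (finish-merging (λ c _ c<n → ℕₚ.<-≤-trans c<n n≤k) cur)
    where open MergeState M
  ... | tri> _ _ q<q′ = record
    { inside = λ c start≤c _ c<n → contradiction c<n (ℕₚ.≤⇒≯ (ℕₚ.≤-trans n≤start start≤c))
    ; rising = λ c d start≤c c<d _ d<n → contradiction d<n (ℕₚ.≤⇒≯ (ℕₚ.≤-trans n≤start (ℕₚ.≤-trans start≤c (ℕₚ.<⇒≤ c<d)))) }
    where
    open MergeState M
    n≤start : n ≤ q′ * (w + w)
    n≤start = ℕₚ.≤-trans n≤k (ℕₚ.≤-trans k≤hi (ℕₚ.≤-trans (ℕₚ.≤-reflexive
      (trans hi≡ (trans (cong (_+ w) mid≡) (trans (ℕₚ.+-assoc lo w w) (ℕₚ.+-comm lo (w + w))))))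
      (ℕₚ.*-monoˡ-≤ (w + w) q<q′)))

-- The constant comes first, so that the new value reduces to a successor.
increment : ∀ {k l} → Fin k → Cmd k l
increment a = a := const 1 ⊕ ! a

-- Integer arrays: 0 output, 1 sorted point indices, 2 merge buffer, 3 block width,
-- 4 output position, 5 and 6 heads of the two blocks being merged, 7 and 8 their
-- ends.  A pass is a single loop over the output positions, so its n steps take
-- constant time each.
fill-step fill merge-emit merge-renew merge-start copy-step merge-pass sort : Cmd 10 2
fill-step = #1 [ ! #4 ]:= ! #4 ⨾ increment #4
fill = #4 := const 0 ⨾ while ltⁱ (! #4) #points loop fill-step
merge-emit =
  ifᵇ andᵇ (ltⁱ (! #6) (! #8)) (andᵇ (ltⁱ (! #6) #points) (notᵇ (andᵇ (ltⁱ (! #5) (! #7))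
        (ltʳ (coord₁ (load #1 (! #5))) (coord₁ (load #1 (! #6)))))))
  then #2 [ ! #4 ]:= load #1 (! #6) ⨾ increment #6 ⨾ increment #4
  else (#2 [ ! #4 ]:= load #1 (! #5) ⨾ increment #5 ⨾ increment #4)
merge-renew = ifᵇ ltⁱ (! #4) (! #8) then skip
  else (#5 := ! #4 ⨾ #7 := ! #4 ⊕ ! #3 ⨾ #6 := ! #7 ⨾ #8 := ! #6 ⊕ ! #3)
merge-start = #4 := const 0 ⨾ #5 := const 0 ⨾ #7 := ! #3 ⨾ #6 := ! #3 ⨾ #8 := ! #3 ⊕ ! #3
copy-step = #1 [ ! #4 ]:= load #2 (! #4) ⨾ increment #4
merge-pass =
  merge-start ⨾ while ltⁱ (! #4) #points loop (merge-emit ⨾ merge-renew) ⨾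
  #4 := const 0 ⨾ while ltⁱ (! #4) #points loop copy-step ⨾
  #3 := ! #3 ⊕ ! #3
sort = fill ⨾ #3 := const 1 ⨾ while ltⁱ (! #3) #points loop merge-pass

fill-time pass-time : ℕ → ℕ
fill-time n = 3 + while-time 4 (costᶜ fill-step) n
pass-time n = costᶜ merge-start + (while-time 4 (costᶜ (merge-emit ⨾ merge-renew)) n +
  (3 + (while-time 4 (costᶜ copy-step) n + 7)))

-- The width doubles with every pass, so its rounded logarithm grows by 1. A last width below `n`
-- may have the same rounded logarithm as `n`, hence the `suc`.
sort-time : ℕ → ℕ
sort-time n = fill-time n + (3 + while-time 4 (pass-time n) (suc ⌈log₂ n ⌉))

-- Correctness and running time of the sorting program

module Sort (R : RealNumbers) (α : RealNumbers.Carrier R)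
            (0<α : RealNumbers._<ʳ_ R (RealNumbers.0# R) α)
            (W p : ℕ) {n : ℕ} (x : Fin n → Problem.Point R α)
            (pareto : Problem.IsParetoFront R α x)
            (2≤W : 2 ≤ W) (n+n+n≤W : n + n + n ≤ W) (p≤W : p ≤ W) (2≤n : 2 ≤ n) where

  n≤W : n ≤ W
  n≤W = ℕₚ.≤-trans (ℕₚ.m≤n+m n (n + n)) n+n+n≤W

  0<n : 0 < n
  0<n = ℕₚ.<⇒≤ 2≤n

  open RealNumbers R
  open Problem R α
  open OrderedField R
  open Machine R α W n p x
  open Hoare R α W n p x 2≤W n≤W p≤W 0<n
  open Points R α 0<α W n p x pareto
  open Merge R α 0<α W n p x pareto

  +-≤W : ∀ {a b} → a ≤ n → b ≤ n → a + b ≤ W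
  +-≤W a≤n b≤n = ℕₚ.≤-trans (ℕₚ.+-mono-≤ a≤n b≤n) (ℕₚ.≤-trans (ℕₚ.m≤m+n (n + n) n) n+n+n≤W)

  counting : ∀ {k k′} → k′ ≡ suc k → k < n → n ∸ k′ < n ∸ k
  counting refl k<n = ℕₚ.∸-monoʳ-< ℕₚ.≤-refl k<n

  fill-runs : ∀ {s} → Runs fill s (fill-time n) (λ s′ → BlockSorted 1 (ints s′ #1))
  fill-runs = straight (#4 := const 0) {Q = Inv} (z≤n , λ _ ()) ⨟
    λ {s} i → relax ℕₚ.≤-refl (λ ((_ , eq) , n≤k) → identity-sorted (λ m m<n → eq m (ℕₚ.<-≤-trans m<n n≤k)))
      (iterate Inv (λ s → n ∸ ints s #4 0) _ _ (λ {s} i k<n → straight fill-step (body {s} i k<n))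
        n (ℕₚ.m∸n≤m n (ints s #4 0)) i)
    where
    Inv : State 10 2 → Set
    Inv s = ints s #4 0 ≤ n × (∀ m → m < ints s #4 0 → ints s #1 m ≡ m)
    body : ∀ {s} → Inv s → ints s #4 0 < n → wp fill-step (λ s′ → Inv s′ × n ∸ ints s′ #4 0 < n ∸ ints s #4 0) s
    body {s} (_ , eq) k<n = k<n , _ , ℕₚ.≤-trans k<n n≤W , (k<n , <1+-elim _
        (λ m m<k → trans (elsewhere (ℕₚ.<⇒≢ m<k)) (eq m m<k)) at-index) , counting refl k<n
      where open Updated (update-spec (ints s) #1 (ints s #4 0) (ints s #4 0))

  module Pass (w₀ : ℕ) (0<w₀ : 0 < w₀) (w₀<n : w₀ < n) where

    Cursor : State 10 2 → Set
    Cursor s = MergeState (ints s #3 0) (ints s #4 0) (ints s #5 0) (ints s #6 0) (ints s #7 0) (ints s #8 0)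
                          (ints s #1) (ints s #2)

    -- Emitting an entry may exhaust the current pair of blocks; `Between` drops the condition
    -- `k < hi`, which `merge-renew` restores.
    Between Inv : State 10 2 → Set
    Between s = ints s #3 0 ≡ w₀ × BlockSorted (ints s #3 0) (ints s #1) × Cursor s
    Inv s = Between s × ints s #4 0 < ints s #8 0

    -- The last block may end beyond `n`, but its end is at most `lo + w + w`; this is the origin of
    -- the bound `n + n + n ≤ W`.
    hi≤W : ∀ {w k i j mid hi a b} → w ≡ w₀ → k < n → MergeState w k i j mid hi a b → hi ≤ W
    hi≤W refl k<n M = ℕₚ.≤-trans (ℕₚ.≤-trans (ℕₚ.≤-reflexive (trans hi≡ (cong (_+ w₀) mid≡)))
      (ℕₚ.+-mono-≤ (ℕₚ.+-mono-≤ (ℕₚ.≤-trans lo≤k (ℕₚ.<⇒≤ k<n)) (ℕₚ.<⇒≤ w₀<n)) (ℕₚ.<⇒≤ w₀<n))) n+n+n≤W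
      where open MergeState M

    emit : ∀ {s} → Inv s → ints s #4 0 < n →
      wp merge-emit (λ s′ → Between s′ × ints s′ #4 0 ≡ suc (ints s #4 0)) s
    emit {s} ((w≡ , sorted , M) , k<hi) k<n =
      (λ j<hi → (λ j<n → (λ i<mid → i<n′ , proj₂ (proj₂ (left-inside M sorted k<hi k<n i<mid)) ,
          j<n , proj₂ (proj₂ (right-inside M sorted k<hi k<n j<hi j<n)) , _) , _) , _) ,
      (λ (j<hi , j<n , why) → k<n , j<n , _ , ℕₚ.≤-trans j<hi (hi≤W w≡ k<n M) , _ , 1+k≤W ,
        (w≡ , sorted , emit-right M sorted k<hi k<n j<hi j<n why (update-spec (ints s) #2 (ints s #4 0) _)) , refl) ,
      (λ why → k<n , i<n′ , _ , ℕₚ.≤-trans i<n′ n≤W , _ , 1+k≤W ,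
        (w≡ , sorted , emit-left M sorted k<hi k<n why (update-spec (ints s) #2 (ints s #4 0) _)) , refl)
      where
      i<n′ : ints s #5 0 < n
      i<n′ = i<n M sorted k<hi k<n
      1+k≤W : suc (ints s #4 0) ≤ W
      1+k≤W = ℕₚ.≤-trans k<n n≤W

    renew : ∀ {s k′} → Between s → ints s #4 0 ≡ k′ → wp merge-renew (λ s′ → Inv s′ × ints s′ #4 0 ≡ k′) s
    renew {s} (w≡ , sorted , M) k≡ =
      (λ k<hi → ((w≡ , sorted , M) , k<hi) , k≡) ,
      (λ hi≤k → _ , +-≤W k≤n w≤n , _ , ℕₚ.≤-trans (ℕₚ.+-mono-≤ (ℕₚ.+-mono-≤ k≤n w≤n) w≤n) n+n+n≤W ,
        ((w≡ , sorted , next-block M hi≤k) ,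
         ℕₚ.<-≤-trans (ℕₚ.m<m+n _ (subst (0 <_) (sym w≡) 0<w₀)) (ℕₚ.m≤m+n _ _)) , k≡)
      where
      open MergeState M
      w≤n : ints s #3 0 ≤ n
      w≤n = subst (_≤ n) (sym w≡) (ℕₚ.<⇒≤ w₀<n)

    CopyInv : State 10 2 → Set
    CopyInv s = ints s #3 0 ≡ w₀ × BlockSorted (ints s #3 0 + ints s #3 0) (ints s #2) ×
      ints s #4 0 ≤ n × (∀ m → m < ints s #4 0 → ints s #1 m ≡ ints s #2 m)

    copy : ∀ {s} → CopyInv s → ints s #4 0 < n →
      wp copy-step (λ s′ → CopyInv s′ × n ∸ ints s′ #4 0 < n ∸ ints s #4 0) s
    copy {s} (w≡ , sorted , _ , eq) k<n = k<n , k<n , _ , ℕₚ.≤-trans k<n n≤W ,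
      (w≡ , sorted , k<n , <1+-elim _ (λ m m<k → trans (elsewhere (ℕₚ.<⇒≢ m<k)) (eq m m<k)) at-index) ,
      counting refl k<n
      where open Updated (update-spec (ints s) #1 (ints s #4 0) (ints s #2 (ints s #4 0)))

    pass-runs : ∀ {s} → ints s #3 0 ≡ w₀ → BlockSorted (ints s #3 0) (ints s #1) →
      Runs merge-pass s (pass-time n) (λ s′ → ints s′ #3 0 ≡ w₀ + w₀ × BlockSorted (ints s′ #3 0) (ints s′ #1))
    pass-runs {s} w≡ sorted =
      straight merge-start {Q = Inv} (_ , +-≤W w≤n w≤n ,
        ((w≡ , sorted , first-block) , ℕₚ.<-≤-trans 0<w (ℕₚ.m≤m+n _ _))) ⨟
      λ {s} i → iterate Inv (λ s → n ∸ ints s #4 0) (costᶜ (merge-emit ⨾ merge-renew)) _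
        (λ {s} i k<n → straight merge-emit {Q = λ s′ → Between s′ × ints s′ #4 0 ≡ suc (ints s #4 0)} (emit {s} i k<n) ⨟
          λ { {s′} (b , k≡) → relax ℕₚ.≤-refl (λ (i , k≡) → i , counting k≡ k<n)
            (straight merge-renew {Q = λ s″ → Inv s″ × ints s″ #4 0 ≡ suc (ints s #4 0)} (renew {s′} b k≡)) })
        n (ℕₚ.m∸n≤m n (ints s #4 0)) i ⨟
      λ { (((w≡ , _ , M) , _) , n≤k) → straight (#4 := const 0) {Q = CopyInv} (w≡ , all-merged M n≤k , z≤n , λ _ ()) ⨟
      λ {s} i → iterate CopyInv (λ s → n ∸ ints s #4 0) (costᶜ copy-step) _
        (λ {s} i k<n → straight copy-step (copy {s} i k<n)) n (ℕₚ.m∸n≤m n (ints s #4 0)) i ⨟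
      λ { {s} ((w≡ , sorted , k≤n , eq) , n≤k) → straight (#3 := ! #3 ⊕ ! #3)
        (_ , +-≤W (bound≤n w≡) (bound≤n w≡) , trans (cong (_+ ints s #3 0) w≡) (cong (w₀ +_) w≡) ,
         λ q → sortedOn-resp (λ c _ c<n → eq c (ℕₚ.<-≤-trans c<n n≤k)) (sorted q)) } }
      where
      bound≤n : ∀ {w} → w ≡ w₀ → w ≤ n
      bound≤n refl = ℕₚ.<⇒≤ w₀<n
      w≤n = bound≤n w≡
      0<w : 0 < ints s #3 0
      0<w = subst (0 <_) (sym w≡) 0<w₀

  sorted⇒ordered : ∀ {w a} → n ≤ w → BlockSorted w a → Ordered a
  sorted⇒ordered {w} {a} n≤w sorted = record
    { index<n = index<n
    ; ascends = λ l m l<m m<n → let l⊏m = rising l m z≤n l<m (ℕₚ.<-≤-trans m<n n≤w) m<n in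
        abscissa-≤⇒≺ (index<n l (ℕₚ.<-trans l<m m<n)) (index<n m m<n)
          (λ eq → <ʳ-irrefl (≈-reflexive (cong abscissa eq)) l⊏m) (inj₁ l⊏m) }
    where
    open SortedOn (sorted 0)
    index<n : ∀ m → m < n → a m < n
    index<n m m<n = proj₂ (proj₂ (inside m z≤n (ℕₚ.<-≤-trans m<n n≤w) m<n))

  sort-runs : ∀ {s} → Runs sort s (sort-time n) (λ s′ → Ordered (ints s′ #1))
  sort-runs = fill-runs ⨟
    λ sorted → straight (#3 := const 1) {Q = Inv} (ℕₚ.≤-refl , sorted) ⨟
    λ {s} i → relax ℕₚ.≤-refl (λ ((_ , sorted) , n≤w) → sorted⇒ordered n≤w sorted)
      (iterate Inv (λ s → suc ⌈log₂ n ⌉ ∸ ⌈log₂ ints s #3 0 ⌉) (pass-time n) _ body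
        (suc ⌈log₂ n ⌉) (ℕₚ.m∸n≤m (suc ⌈log₂ n ⌉) ⌈log₂ ints s #3 0 ⌉) i)
    where
    Inv : State 10 2 → Set
    Inv s = 0 < ints s #3 0 × BlockSorted (ints s #3 0) (ints s #1)
    body : ∀ {s} → Inv s → ints s #3 0 < n → Runs merge-pass s (pass-time n)
      (λ s′ → Inv s′ × suc ⌈log₂ n ⌉ ∸ ⌈log₂ ints s′ #3 0 ⌉ < suc ⌈log₂ n ⌉ ∸ ⌈log₂ ints s #3 0 ⌉)
    body {s} (0<w , sorted) w<n = relax ℕₚ.≤-refl
      (λ (w′≡ , sorted′) → (subst (0 <_) (sym w′≡) (ℕₚ.<-≤-trans 0<w (ℕₚ.m≤m+n w w)) , sorted′) ,
        ℕₚ.∸-monoʳ-< (ℕₚ.≤-reflexive (sym (log-double w′≡)))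
          (subst (_≤ suc ⌈log₂ n ⌉) (sym (log-double w′≡)) (s≤s (⌈log₂⌉-mono-≤ (ℕₚ.<⇒≤ w<n)))))
      (Pass.pass-runs w 0<w w<n refl sorted)
      where
      w = ints s #3 0
      log-double : ∀ {w′} → w′ ≡ w + w → ⌈log₂ w′ ⌉ ≡ suc ⌈log₂ w ⌉
      log-double refl = trans (cong (λ v → ⌈log₂ (w + v) ⌉) (sym (ℕₚ.+-identityʳ w)))
        (⌈log₂2*n⌉≡1+⌈log₂n⌉ w {{>-nonZero 0<w}})

-- Dynamic programming

-- Pigeonhole: a missed value could be punched out of the codomain. The sorted array is known only
-- to be in range and ascending; that every input point occurs in it is deduced from this.
injective⇒surjective : ∀ {n} {f : Fin n → Fin n} → Injective _≡_ _≡_ f → ∀ y → ∃[ i ] f i ≡ y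
injective⇒surjective {suc n} {f} inj y with Finₚ.any? (λ i → f i Finₚ.≟ y)
... | yes found = found
... | no  missed = contradiction (Finₚ.injective⇒≤ {f = λ i → punchOut (≢y i)}
        (λ {i} {j} eq → inj (Finₚ.punchOut-injective (≢y i) (≢y j) eq))) (ℕₚ.<⇒≱ ℕₚ.≤-refl)
  where
  ≢y : ∀ i → y ≢ f i
  ≢y i eq = missed (i , sym eq)

module Positions (R : RealNumbers) (α : RealNumbers.Carrier R)
            (0<α : RealNumbers._<ʳ_ R (RealNumbers.0# R) α)
            (W S p : ℕ) {n : ℕ} (x : Fin n → Problem.Point R α)
            (pareto : Problem.IsParetoFront R α x) (a : ℕ → ℕ)
            (ordered : Points.Ordered R α 0<α W S p x pareto a) where
  open RealNumbers R
  open Problem R α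
  open OrderedField R
  open Geometry R α 0<α
  open Chains R α 0<α x pareto
  open Machine R α W S p x using (inputPoint)
  open Points R α 0<α W S p x pareto
  open Points.Ordered ordered

  at : ℕ → Point
  at m = inputPoint (a m)

  gapAt : ℕ → ℕ → Carrier
  gapAt l m = gap (a l) (a m)

  at-mono : ∀ {l m} → l ≤ m → m < n → at l ≼ at m
  at-mono l≤m m<n with ℕₚ.m≤n⇒m<n∨m≡n l≤m
  ... | inj₁ l<m  = ≺⇒≼ (ascends _ _ l<m m<n)
  ... | inj₂ refl = ≼-refl

  gapAt-nested : ∀ {i j k l} → i ≤ j → j ≤ k → k ≤ l → l < n → gapAt j k ≤ʳ gapAt i l
  gapAt-nested i≤j j≤k k≤l l<n = dist^α-nested (at-mono i≤j (ℕₚ.≤-<-trans j≤k k<n)) (at-mono j≤k k<n) (at-mono k≤l l<n)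
    where k<n = ℕₚ.≤-<-trans k≤l l<n

  gapAt-diag : ∀ m → gapAt m m ≈ 0#
  gapAt-diag m = dist^α-diag (at m)

  gapAt-pos : ∀ {l m} → l < m → m < n → 0# <ʳ gapAt l m
  gapAt-pos l<m m<n = dist^α-pos (ascends _ _ l<m m<n)

  position : ∀ i → ∃[ m ] (m < n × x i ≡ at m)
  position i with injective⇒surjective {f = place} place-injective i
    where
    place : Fin n → Fin n
    place m = fromℕ< (index<n (toℕ m) (Finₚ.toℕ<n m))
    a-injective : ∀ {l m} → l < n → m < n → a l ≡ a m → l ≡ m
    a-injective {l} {m} l<n m<n eq with ℕₚ.<-cmp l m
    ... | tri≈ _ l≡m _ = l≡m
    ... | tri< l<m _ _ = contradiction (proj₁ (ascends l m l<m m<n)) (<ʳ-irrefl (≈-reflexive (cong abscissa eq)))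
    ... | tri> _ _ m<l = contradiction (proj₁ (ascends m l m<l l<n)) (<ʳ-irrefl (≈-reflexive (cong abscissa (sym eq))))
    place-injective : Injective _≡_ _≡_ place
    place-injective {l} {m} eq = Finₚ.toℕ-injective (a-injective (Finₚ.toℕ<n l) (Finₚ.toℕ<n m)
      (Finₚ.fromℕ<-injective _ _ (index<n _ (Finₚ.toℕ<n l)) (index<n _ (Finₚ.toℕ<n m)) eq))
  ... | m , refl = toℕ m , Finₚ.toℕ<n m , sym (inputPoint-fromℕ< (index<n (toℕ m) (Finₚ.toℕ<n m)))

  step-at : ∀ {v k j i} → j ≤ i → i < n → v ≤ʳ gapAt j i → Chain v k (at j) → Chain v (suc k) (at i)
  step-at {v} {k} {j} {i} j≤i i<n v≤ c = step index
    (subst (_≼ at i) eq (at-mono j≤i i<n)) (subst (λ z → v ≤ʳ dist^α z (at i)) eq v≤) (subst (Chain v k) eq c)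
    where
    j<n = ℕₚ.≤-<-trans j≤i i<n
    index : Fin n
    index = fromℕ< (index<n j j<n)
    eq : at j ≡ x index
    eq = inputPoint-fromℕ< (index<n j j<n)

  -- With `step-at` this expresses chains by positions in the sorted order, which is the recurrence
  -- of the dynamic program.
  unstep-at : ∀ {v k i} → i < n → Chain v (suc k) (at i) → ∃[ j ] (j ≤ i × v ≤ʳ gapAt j i × Chain v k (at j))
  unstep-at {v} {k} {i} i<n (step index ≼i v≤ c) with position index
  ... | j , j<n , eq = j , ℕₚ.≮⇒≥ (λ i<j → ≺⇒⋡ (ascends i j i<j j<n) (subst (_≼ at i) eq ≼i)) ,
        subst (λ z → v ≤ʳ dist^α z (at i)) eq v≤ , subst (Chain v k) eq c

  chain-mono : ∀ {v k j i} → j ≤ i → i < n → Chain v k (at j) → Chain v k (at i)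
  chain-mono j≤i i<n = chain-extend (at-mono j≤i i<n)

  -- Staying at one point gives gaps equal to 0, so table values are nonnegative everywhere.
  zero-chain : ∀ k {i} → i < n → Chain 0# k (at i)
  zero-chain zero    i<n = start
  zero-chain (suc k) i<n = step-at ℕₚ.≤-refl i<n (≤ʳ-reflexive (≈-sym (gapAt-diag _))) (zero-chain k i<n)

  positive-chain : ∀ k {i} → k ≤ i → i < n → ∃[ v ] (0# <ʳ v × Chain v k (at i))
  -- Without gaps any positive number serves; `0≉1` provides one, whichever way 0 and 1 compare.
  positive-chain zero {i} _ i<n with compareʳ 0# 1#
  ... | tri< 0<1 _ _ = 1# , 0<1 , start
  ... | tri≈ _ 0≈1 _ = contradiction 0≈1 0≉1
  ... | tri> _ _ 1<0 = _ , x<y⇒0<y-x 1<0 , start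
  positive-chain (suc k) {suc i} (s≤s k≤i) 1+i<n with positive-chain k k≤i (ℕₚ.<-trans ℕₚ.≤-refl 1+i<n)
  ... | v , 0<v , c with ≤ʳ-total v (gapAt i (suc i))
  ...   | inj₁ v≤ = v , 0<v , step-at (ℕₚ.n≤1+n i) 1+i<n v≤ c
  ...   | inj₂ v≥ = _ , gapAt-pos ℕₚ.≤-refl 1+i<n , step-at (ℕₚ.n≤1+n i) 1+i<n ≤ʳ-refl (chain-weaken v≥ c)

  record Best (k i : ℕ) (v : Carrier) : Set where
    constructor best
    field
      achieved : Chain v k (at i)
      maximal  : ∀ u → Chain u k (at i) → u ≤ʳ v

  best-nonneg : ∀ {k i v} → i < n → Best k i v → 0# ≤ʳ v
  best-nonneg {k} i<n b = Best.maximal b 0# (zero-chain k i<n)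

  -- The table starts at one gap: with none, every value is achieved and there is no best one.
  best-one-gap : ∀ {i} → i < n → Best 1 i (gapAt 0 i)
  best-one-gap {i} i<n = best (step-at z≤n i<n ≤ʳ-refl start) upper
    where
    upper : ∀ u → Chain u 1 (at i) → u ≤ʳ gapAt 0 i
    upper u c with unstep-at i<n c
    ... | j , j≤i , u≤ , _ = ≤ʳ-trans u≤ (gapAt-nested z≤n j≤i ℕₚ.≤-refl i<n)

  best-first : ∀ {k v} → 0 < n → v ≈ 0# → Best (suc k) 0 v
  best-first {k} {v} 0<n v≈0 = best (chain-weaken (≤ʳ-reflexive v≈0) (zero-chain (suc k) 0<n)) upper
    where
    upper : ∀ u → Chain u (suc k) (at 0) → u ≤ʳ v
    upper u c with unstep-at 0<n c
    ... | zero , _ , u≤ , _ = ≤ʳ-trans u≤ (≤ʳ-reflexive (≈-trans (gapAt-diag 0) (≈-sym v≈0)))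

  -- One row of the dynamic program, computed in place from right to left: f
  -- holds values for k gaps up to i and for k + 1 gaps after it.  As f increases and
  -- gapAt · i decreases, min (f m) (gapAt m i) is greatest at the crossing, which
  -- moves left together with i; every position in (j , i] lies beyond it.
  record Row (k i j : ℕ) (f : ℕ → Carrier) : Set where
    field
      i<n    : i < n
      j≤i    : j ≤ i
      first  : f 0 ≈ 0#
      old    : ∀ m → m ≤ i → Best k m (f m)
      new    : ∀ m → i < m → m < n → Best (suc k) m (f m)
      beyond : ∀ m → j < m → m ≤ i → gapAt m i ≤ʳ f m

  start-row : ∀ {k f l} → suc l ≡ n → f 0 ≈ 0# → (∀ m → m < n → Best k m (f m)) → Row k l l f
  start-row refl first all = record
    { i<n = ℕₚ.≤-refl ; j≤i = ℕₚ.≤-refl ; first = first ; old = λ m m≤l → all m (s≤s m≤l)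
    ; new = λ m l<m m<n → contradiction m<n (ℕₚ.≤⇒≯ l<m)
    ; beyond = λ m l<m m≤l → contradiction m≤l (ℕₚ.<⇒≱ l<m) }

  -- The loop stops at position 0 without rewriting its entry, whose value is 0 for any positive
  -- number of gaps.
  finish-row : ∀ {k i j f} → Row k i j f → i ≤ 0 → ∀ m → m < n → Best (suc k) m (f m)
  finish-row row i≤0 zero    0<n = best-first 0<n (Row.first row)
  finish-row row i≤0 (suc m) m<n = Row.new row (suc m) (s≤s (ℕₚ.≤-trans i≤0 z≤n)) m<n

  module _ {k i j f} (row : Row k i j f) where
    open Row row

    j<i : f j <ʳ gapAt j i → j < i
    j<i f<gap with ℕₚ.m≤n⇒m<n∨m≡n j≤i
    ... | inj₁ lt   = lt
    ... | inj₂ refl = contradiction (<-≤ʳ-trans f<gap (≤ʳ-reflexive (gapAt-diag i)))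
          (≤ʳ⇒≯ʳ (best-nonneg i<n (old i ℕₚ.≤-refl)))

    -- The possible predecessors of `i` split at `j`: those beyond have a gap no larger than that of
    -- `suc j`, the others a table value no larger than that of `j`.
    crossing : f j <ʳ gapAt j i → ∀ {v} → f j ≤ʳ v → gapAt (suc j) i ≤ʳ v → ∀ u → Chain u (suc k) (at i) → u ≤ʳ v
    crossing f<gap f≤v gap≤v u c with unstep-at i<n c
    ... | m , m≤i , u≤gap , c′ with ℕₚ.<-cmp j m
    ...   | tri< j<m _ _  = ≤ʳ-trans u≤gap (≤ʳ-trans (gapAt-nested j<m m≤i ℕₚ.≤-refl i<n) gap≤v)
    ...   | tri≈ _ refl _ = ≤ʳ-trans (Best.maximal (old j j≤i) u c′) f≤v
    ...   | tri> _ _ m<j  = ≤ʳ-trans (Best.maximal (old j j≤i) u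
              (chain-mono (ℕₚ.<⇒≤ m<j) (ℕₚ.≤-<-trans j≤i i<n) c′)) f≤v

    best-left : f j <ʳ gapAt j i → gapAt (suc j) i ≤ʳ f j → Best (suc k) i (f j)
    best-left f<gap gap≤f = best (step-at j≤i i<n (inj₁ f<gap) (Best.achieved (old j j≤i)))
      (crossing f<gap ≤ʳ-refl gap≤f)

    -- `beyond` at `suc j` makes the gap, not the table value, the smaller of the two terms there,
    -- so the gap is achieved.
    best-right : f j <ʳ gapAt j i → f j ≤ʳ gapAt (suc j) i → Best (suc k) i (gapAt (suc j) i)
    best-right f<gap f≤gap = best
      (step-at (j<i f<gap) i<n ≤ʳ-refl (chain-weaken (beyond (suc j) ℕₚ.≤-refl (j<i f<gap))
        (Best.achieved (old (suc j) (j<i f<gap)))))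
      (crossing f<gap f≤gap ≤ʳ-refl)

  -- Passing to `i - 1` shrinks the gaps, so `beyond` persists and `j` need not move back to the
  -- right.
  row-write : ∀ {k i j f f′ v} → Row k i j f → f j <ʳ gapAt j i → Best (suc k) i v → Updated f i v f′ →
    Row k (i ∸ 1) j f′
  row-write {i = zero} row f<gap b up = contradiction (j<i row f<gap) λ ()
  row-write {k} {suc i} {j} {f} {f′} row f<gap b up = record
    { i<n = ℕₚ.<-trans ℕₚ.≤-refl i<n ; j≤i = s≤s⁻¹ (j<i row f<gap)
    ; first = ≈-trans (≈-reflexive (elsewhere λ ())) first
    ; old = λ m m≤i → subst (Best k m) (sym (elsewhere (ℕₚ.<⇒≢ (s≤s m≤i)))) (old m (ℕₚ.m≤n⇒m≤1+n m≤i))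
    ; new = λ m i<m m<n → newly m (ℕₚ.m≤n⇒m<n∨m≡n i<m) m<n
    ; beyond = λ m j<m m≤i → ≤ʳ-trans (gapAt-nested ℕₚ.≤-refl m≤i (ℕₚ.n≤1+n i) i<n)
        (≤ʳ-trans (beyond m j<m (ℕₚ.m≤n⇒m≤1+n m≤i)) (≤ʳ-reflexive (≈-reflexive (sym (elsewhere (ℕₚ.<⇒≢ (s≤s m≤i))))))) }
    where
    open Row row
    open Updated up
    newly : ∀ m → suc i < m ⊎ suc i ≡ m → m < n → Best (suc k) m (f′ m)
    newly m (inj₁ 1+i<m) m<n = subst (Best (suc k) m) (sym (elsewhere (ℕₚ.>⇒≢ 1+i<m))) (new m 1+i<m m<n)
    newly m (inj₂ refl)  m<n = subst (Best (suc k) m) (sym at-index) b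

  -- `j` cannot run off the left end: at position 0 the table value is 0, while the gap to `i` is
  -- positive.
  row-skip : ∀ {k i j f} → Row k i j f → 0 < i → gapAt j i ≤ʳ f j → 0 < j × Row k i (j ∸ 1) f
  row-skip {j = zero} row 0<i gap≤f = contradiction
    (<-≤ʳ-trans (gapAt-pos 0<i i<n) (≤ʳ-trans gap≤f (≤ʳ-reflexive first))) (<ʳ-irrefl ≈-refl)
    where open Row row
  row-skip {i = i} {suc j} {f} row 0<i gap≤f = s≤s z≤n , record
    { i<n = i<n ; j≤i = ℕₚ.≤-trans (ℕₚ.n≤1+n j) j≤i ; first = first ; old = old ; new = new
    ; beyond = λ m j<m m≤i → further m (ℕₚ.m≤n⇒m<n∨m≡n j<m) m≤i }
    where
    open Row row
    further : ∀ m → suc j < m ⊎ suc j ≡ m → m ≤ i → gapAt m i ≤ʳ f m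
    further m (inj₁ 1+j<m) = beyond m 1+j<m
    further m (inj₂ refl)  _ = gap≤f

  -- o m, for m ≥ r, are the points chosen so far, the leftmost one being at j; a
  -- point completing them with r gaps of at least v is to be found at or left of i.
  record Trace (k r i j : ℕ) (v : Carrier) (o : ℕ → ℕ) : Set where
    field
      r≤k     : r ≤ k
      i≤j     : i ≤ j
      j<n     : j < n
      pending : ∀ r′ → r ≡ suc r′ → ∃[ m ] (m ≤ i × v ≤ʳ gapAt m j × Chain v r′ (at m))
      leftmost : o r ≡ a j
      chosen  : ∀ m → r ≤ m → m ≤ k → o m < n
      rising  : ∀ m → r ≤ m → m < k → inputPoint (o m) ≺ inputPoint (o (suc m))
      gaps    : ∀ m → r ≤ m → m < k → v ≤ʳ gap (o m) (o (suc m))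

  start-trace : ∀ {k v o o′ l} → l < n → Chain v k (at l) → Updated o k (a l) o′ → Trace k k l l v o′
  start-trace {k} {v} {o} {o′} {l} l<n c up = record
    { r≤k = ℕₚ.≤-refl ; i≤j = ℕₚ.≤-refl ; j<n = l<n
    ; pending = λ { r′ refl → unstep-at l<n c }
    ; leftmost = at-index
    ; chosen = λ m k≤m m≤k → subst (_< n) (sym (trans (cong o′ (ℕₚ.≤-antisym m≤k k≤m)) at-index)) (index<n l l<n)
    ; rising = λ m k≤m m<k → contradiction m<k (ℕₚ.≤⇒≯ k≤m)
    ; gaps = λ m k≤m m<k → contradiction m<k (ℕₚ.≤⇒≯ k≤m) }
    where open Updated up

  -- The pending predecessor cannot be `i`, whose gap is too small, so it lies further left and `i`
  -- is not the first position.
  trace-skip : ∀ {k r i j v o} → Trace k r i j v o → 0 < r → gapAt i j <ʳ v → 0 < i × Trace k r (i ∸ 1) j v o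
  trace-skip {r = suc r} {i} {j} {v} T 0<r gap<v with Trace.pending T r refl
  ... | m , m≤i , v≤gap , c with ℕₚ.m≤n⇒m<n∨m≡n m≤i
  ...   | inj₂ refl = contradiction gap<v (≤ʳ⇒≯ʳ v≤gap)
  ...   | inj₁ (s≤s {n = i′} m≤i′) = s≤s z≤n , record
    { r≤k = r≤k ; i≤j = ℕₚ.≤-trans (ℕₚ.n≤1+n i′) i≤j ; j<n = j<n
    ; pending = λ { r′ refl → m , m≤i′ , v≤gap , c }
    ; leftmost = leftmost ; chosen = chosen ; rising = rising ; gaps = gaps }
    where open Trace T

  -- The greedy choice is safe: the pending predecessor lies at or left of `i`, and a chain into it
  -- is also a chain into `i`.
  trace-take : ∀ {k r i j v o o′} → Trace k r i j v o → 0 < r → 0# <ʳ v → v ≤ʳ gapAt i j →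
    Updated o (r ∸ 1) (a i) o′ → Trace k (r ∸ 1) i i v o′
  trace-take {k} {suc r} {i} {j} {v} {o} {o′} T 0<r 0<v v≤gap up = record
    { r≤k = ℕₚ.<⇒≤ r≤k ; i≤j = ℕₚ.≤-refl ; j<n = i<n
    ; pending = λ { r′ refl → unstep-at i<n here }
    ; leftmost = at-index
    ; chosen = λ m r≤m m≤k → by-cases (λ m → m ≤ k → o′ m < n)
        (λ _ → subst (_< n) (sym at-index) (index<n i i<n))
        (λ r<m m≤k → subst (_< n) (sym (kept r<m)) (chosen _ r<m m≤k)) m r≤m m≤k
    ; rising = λ m r≤m m<k → by-cases (λ m → m < k → inputPoint (o′ m) ≺ inputPoint (o′ (suc m)))
        (λ _ → subst₂ (λ b c → inputPoint b ≺ inputPoint c) (sym at-index) (sym next) (ascends i j i<j j<n))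
        (λ r<m m<k → subst₂ (λ b c → inputPoint b ≺ inputPoint c) (sym (kept r<m)) (sym (kept (ℕₚ.m≤n⇒m≤1+n r<m)))
          (rising _ r<m m<k)) m r≤m m<k
    ; gaps = λ m r≤m m<k → by-cases (λ m → m < k → v ≤ʳ gap (o′ m) (o′ (suc m)))
        (λ _ → subst₂ (λ b c → v ≤ʳ gap b c) (sym at-index) (sym next) v≤gap)
        (λ r<m m<k → subst₂ (λ b c → v ≤ʳ gap b c) (sym (kept r<m)) (sym (kept (ℕₚ.m≤n⇒m≤1+n r<m)))
          (gaps _ r<m m<k)) m r≤m m<k }
    where
    open Trace T
    open Updated up
    -- Each scan begins at the point just chosen; the positive value keeps it from being chosen
    -- again.
    i<j : i < j
    i<j with ℕₚ.m≤n⇒m<n∨m≡n i≤j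
    ... | inj₁ lt   = lt
    ... | inj₂ refl = contradiction (<-≤ʳ-trans 0<v (≤ʳ-trans v≤gap (≤ʳ-reflexive (gapAt-diag i)))) (<ʳ-irrefl ≈-refl)
    i<n : i < n
    i<n = ℕₚ.<-trans i<j j<n
    here : Chain v r (at i)
    here with pending r refl
    ... | m , m≤i , _ , c = chain-mono m≤i i<n c
    kept : ∀ {m} → r < m → o′ m ≡ o m
    kept r<m = elsewhere (ℕₚ.>⇒≢ r<m)
    next : o′ (suc r) ≡ a j
    next = trans (kept ℕₚ.≤-refl) leftmost
    by-cases : ∀ (P : ℕ → Set) → P r → (∀ {m} → r < m → P m) → ∀ m → r ≤ m → P m
    by-cases P at-r later m r≤m with ℕₚ.m≤n⇒m<n∨m≡n r≤m
    ... | inj₁ r<m  = later r<m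
    ... | inj₂ refl = at-r

-- The dynamic program on the machine

decrement : ∀ {k l} → Fin k → Cmd k l
decrement a = a := op monus (! a) (const 1)

last-index : ∀ {k} → IExp k
last-index = op monus #points (const 1)

-- Integer arrays 5 and 6 are the pointers i and j of a row (then the scanning
-- position and the last point chosen), 9 the number of gaps; real arrays: 0 the
-- optimal value, 1 the current row.
base-step base improve row-step row-start row rows choose trace-step trace-start trace : Cmd 10 2
base-step = #1 [ ! #4 ]:=ʳ distance (load #1 (const 0)) (load #1 (! #4)) ⨾ increment #4
base = #4 := const 0 ⨾ while ltⁱ (! #4) #points loop base-step
improve =
  ifᵇ ltʳ (distance (load #1 (const 1 ⊕ ! #6)) (load #1 (! #5))) (load #1 (! #6))
  then #1 [ ! #5 ]:=ʳ load #1 (! #6)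
  else (#1 [ ! #5 ]:=ʳ distance (load #1 (const 1 ⊕ ! #6)) (load #1 (! #5)))
row-step =
  ifᵇ ltʳ (load #1 (! #6)) (distance (load #1 (! #6)) (load #1 (! #5)))
  then improve ⨾ decrement #5
  else decrement #6
row-start = #5 := last-index ⨾ #6 := ! #5
row = row-start ⨾ while ltⁱ (const 0) (! #5) loop row-step ⨾ increment #9
rows = #9 := const 1 ⨾ while ltⁱ (const 1 ⊕ ! #9) #chosen loop row
choose = #0 [ ! #9 ]:= load #1 (! #5)
trace-step =
  ifᵇ ltʳ (distance (load #1 (! #5)) (load #1 (! #6))) (load #0 (const 0))
  then decrement #5
  else (decrement #9 ⨾ #6 := ! #5 ⨾ choose)
trace-start = #0 [ const 0 ]:=ʳ load #1 last-index ⨾ #5 := last-index ⨾ #6 := ! #5 ⨾ choose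
trace = trace-start ⨾ while ltⁱ (const 0) (! #9) loop trace-step

dispersion : Program
dispersion = record { k = 9 ; l = 1 ; code = sort ⨾ base ⨾ rows ⨾ trace }

-- `n + n` bounds a sum of two counters, one of which drops in each round: both pointers of a row,
-- or the position and the number of missing points of the trace.
base-time row-time trace-time : ℕ → ℕ
base-time n = 3 + while-time 4 (costᶜ base-step) n
row-time n = costᶜ row-start + (while-time 4 (costᶜ row-step) (n + n) + 6)
trace-time n = costᶜ trace-start + while-time 4 (costᶜ trace-step) (n + n)

rows-time dispersion-time : ℕ → ℕ → ℕ
rows-time n p = 3 + while-time 6 (row-time n) p
dispersion-time n p = sort-time n + (base-time n + (rows-time n p + trace-time n))

module DynamicProgram (R : RealNumbers) (α : RealNumbers.Carrier R)
            (0<α : RealNumbers._<ʳ_ R (RealNumbers.0# R) α)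
            (W g : ℕ) {n : ℕ} (x : Fin n → Problem.Point R α)
            (pareto : Problem.IsParetoFront R α x)
            (n+n+n≤W : n + n + n ≤ W) (p≤n : suc (suc g) ≤ n) where

  p : ℕ
  p = suc (suc g)

  2≤n : 2 ≤ n
  2≤n = ℕₚ.≤-trans (s≤s (s≤s z≤n)) p≤n

  private
    n≤W′ : n ≤ W
    n≤W′ = ℕₚ.≤-trans (ℕₚ.m≤n+m n (n + n)) n+n+n≤W
    2≤W : 2 ≤ W
    2≤W = ℕₚ.≤-trans 2≤n n≤W′
    p≤W : p ≤ W
    p≤W = ℕₚ.≤-trans p≤n n≤W′

  open Sort R α 0<α W p x pareto 2≤W n+n+n≤W p≤W 2≤n
  open RealNumbers R
  open Problem R α
  open OrderedField R
  open Geometry R α 0<α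
  open Machine R α W n p x
  open Hoare R α W n p x 2≤W n≤W p≤W 0<n
  open Points R α 0<α W n p x pareto
  open Chains R α 0<α x pareto
  open Certificates R α 0<α W n p x pareto
  module At = Positions R α 0<α W n p x pareto

  last : ℕ
  last = n ∸ 1

  1+last≡n : suc last ≡ n
  1+last≡n = ℕₚ.m+[n∸m]≡n 0<n

  last<n : last < n
  last<n = ℕₚ.≤-reflexive 1+last≡n

  ∸1≤W : ∀ {m} → m ≤ n → m ∸ 1 ≤ W
  ∸1≤W {m} m≤n = ℕₚ.≤-trans (ℕₚ.m∸n≤m m 1) (ℕₚ.≤-trans m≤n n≤W)

  ∸1-less : ∀ {m} → 0 < m → m ∸ 1 < m
  ∸1-less (s≤s z≤n) = ℕₚ.≤-refl

  Computed : ℕ → State 10 2 → Set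
  Computed k s = Σ[ o ∈ Ordered (ints s #1) ] reals s #1 0 ≈ 0# ×
    (∀ m → m < n → At.Best (ints s #1) o k m (reals s #1 m))

  base-runs : ∀ {s} → Ordered (ints s #1) → Runs base s (base-time n) (Computed 1)
  base-runs o = straight (#4 := const 0) {Q = Inv} (o , z≤n , λ _ ()) ⨟
    λ {s} i → relax ℕₚ.≤-refl (λ {s} ((o , _ , eq) , n≤k) → finish {s} o (λ m m<n → eq m (ℕₚ.<-≤-trans m<n n≤k)))
      (iterate Inv (λ s → n ∸ ints s #4 0) _ _ (λ {s} i k<n → straight base-step (body {s} i k<n))
        n (ℕₚ.m∸n≤m n (ints s #4 0)) i)
    where
    Inv : State 10 2 → Set
    Inv s = Ordered (ints s #1) × ints s #4 0 ≤ n ×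
      (∀ m → m < ints s #4 0 → reals s #1 m ≡ gap (ints s #1 0) (ints s #1 m))
    body : ∀ {s} → Inv s → ints s #4 0 < n → wp base-step (λ s′ → Inv s′ × n ∸ ints s′ #4 0 < n ∸ ints s #4 0) s
    body {s} (o , _ , eq) k<n = k<n , index<n 0 0<n , index<n 0 0<n ,
      k<n , index<n _ k<n , k<n , index<n _ k<n , _ , ℕₚ.≤-trans k<n n≤W ,
      (o , k<n , <1+-elim _ (λ m m<k → trans (elsewhere (ℕₚ.<⇒≢ m<k)) (eq m m<k)) at-index) , counting refl k<n
      where
      open Ordered o
      open Updated (update-spec (reals s) #1 (ints s #4 0) (gap (ints s #1 0) (ints s #1 (ints s #4 0))))
    finish : ∀ {s} → Ordered (ints s #1) → (∀ m → m < n → reals s #1 m ≡ gap (ints s #1 0) (ints s #1 m)) → Computed 1 s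
    finish {s} o eq = o , ≈-trans (≈-reflexive (eq 0 0<n)) (At.gapAt-diag (ints s #1) o 0) ,
      λ m m<n → subst (At.Best (ints s #1) o 1 m) (sym (eq m m<n)) (At.best-one-gap (ints s #1) o m<n)

  module OneRow (r₀ : ℕ) (1+r₀<p : suc r₀ < p) where

    Inv : State 10 2 → Set
    Inv s = ints s #9 0 ≡ r₀ × Σ[ o ∈ Ordered (ints s #1) ]
      At.Row (ints s #1) o r₀ (ints s #5 0) (ints s #6 0) (reals s #1)

    fuel : State 10 2 → ℕ
    fuel s = ints s #5 0 + ints s #6 0

    body : ∀ {s} → Inv s → 0 < ints s #5 0 → wp row-step (λ s′ → Inv s′ × fuel s′ < fuel s) s
    body {s} (r≡ , o , row) 0<i =
      j<n , j<n , aj<n , j<n , aj<n , i<n , ai<n , i<n , ai<n ,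
      (λ f<gap → let
          j<i   = At.j<i a o row f<gap
          1+j<n = ℕₚ.≤-<-trans j<i i<n
          1+j≤W = ℕₚ.≤-trans (ℕₚ.<⇒≤ 1+j<n) n≤W
          aj′<n = index<n _ 1+j<n
        in _ , 1+j≤W , 1+j<n , aj′<n , _ , 1+j≤W , 1+j<n , aj′<n , i<n , ai<n , i<n , ai<n , j<n ,
        (λ gap<f → i<n , j<n , _ , ∸1≤W (ℕₚ.<⇒≤ i<n) ,
          (r≡ , o , At.row-write a o row f<gap (At.best-left a o row f<gap (inj₁ gap<f))
            (update-spec (reals s) #1 i (reals s #1 j))) , ℕₚ.+-monoˡ-< j (∸1-less 0<i)) ,
        (λ f≤gap → i<n , _ , 1+j≤W , 1+j<n , aj′<n , _ , 1+j≤W , 1+j<n , aj′<n , i<n , ai<n , i<n , ai<n ,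
          _ , ∸1≤W (ℕₚ.<⇒≤ i<n) ,
          (r≡ , o , At.row-write a o row f<gap (At.best-right a o row f<gap f≤gap)
            (update-spec (reals s) #1 i (gap (a (suc j)) (a i)))) , ℕₚ.+-monoˡ-< j (∸1-less 0<i))) ,
      (λ gap≤f → let skipped = At.row-skip a o row 0<i gap≤f in
        _ , ∸1≤W (ℕₚ.<⇒≤ j<n) , (r≡ , o , proj₂ skipped) , ℕₚ.+-monoʳ-< i (∸1-less (proj₁ skipped)))
      where
      a = ints s #1
      i = ints s #5 0
      j = ints s #6 0
      open Ordered o
      open At.Row a o row using (i<n; j≤i)
      j<n : j < n
      j<n = ℕₚ.≤-<-trans j≤i i<n
      ai<n : a i < n
      ai<n = index<n i i<n
      aj<n : a j < n
      aj<n = index<n j j<n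

    row-runs : ∀ {s} → ints s #9 0 ≡ r₀ → Computed r₀ s →
      Runs row s (row-time n) (λ s′ → ints s′ #9 0 ≡ suc r₀ × Computed (suc r₀) s′)
    row-runs r≡ (o , first , all) =
      straight row-start {Q = λ s → Inv s × fuel s ≤ n + n}
        (_ , ∸1≤W ℕₚ.≤-refl , (r≡ , o , At.start-row _ o 1+last≡n first all) ,
         ℕₚ.+-mono-≤ (ℕₚ.<⇒≤ last<n) (ℕₚ.<⇒≤ last<n)) ⨟
      λ (i , ≤n+n) → iterate Inv fuel (costᶜ row-step) _ (λ {s} i 0<i → straight row-step (body {s} i 0<i)) (n + n) ≤n+n i ⨟
      λ { {s} ((r≡ , o , row) , i≤0) → straight (increment #9)
        (_ , ℕₚ.≤-trans (ℕₚ.≤-reflexive (cong suc r≡)) (ℕₚ.≤-trans (ℕₚ.<⇒≤ 1+r₀<p) p≤W) ,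
         (cong suc r≡ , o , At.Row.first row , At.finish-row _ o row i≤0)) }

  Rows : State 10 2 → Set
  Rows s = ints s #9 0 < p × Computed (ints s #9 0) s

  rows-runs : ∀ {s} → Computed 1 s → Runs rows s (rows-time n p) (λ s′ → ints s′ #9 0 ≡ suc g × Computed (suc g) s′)
  rows-runs c = straight (#9 := const 1) {Q = Rows} (s≤s (s≤s z≤n) , c) ⨟
    λ {s} i → relax ℕₚ.≤-refl (λ {s} ((r<p , c) , p≤1+r) → finish {s} (ℕₚ.≤-antisym (s≤s⁻¹ r<p) (s≤s⁻¹ p≤1+r)) c)
      (iterate Rows (λ s → p ∸ ints s #9 0) (row-time n) (λ (r<p , _) → _ , ℕₚ.≤-trans r<p p≤W , _) body
        p (ℕₚ.m∸n≤m p (ints s #9 0)) i)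
    where
    finish : ∀ {s r} → r ≡ suc g → Computed r s → r ≡ suc g × Computed (suc g) s
    finish refl c = refl , c
    body : ∀ {s} → Rows s → suc (ints s #9 0) < p →
      Runs row s (row-time n) (λ s′ → Rows s′ × p ∸ ints s′ #9 0 < p ∸ ints s #9 0)
    body {s} (r<p , c) 1+r<p = relax ℕₚ.≤-refl
      (λ {s′} (r≡ , c) → (subst (_< p) (sym r≡) 1+r<p , subst (λ r → Computed r s′) (sym r≡) c) ,
         subst (λ r → p ∸ r < p ∸ ints s #9 0) (sym r≡) (ℕₚ.∸-monoʳ-< ℕₚ.≤-refl r<p))
      (OneRow.row-runs (ints s #9 0) 1+r<p refl c)

  Tracing : State 10 2 → Set
  Tracing s = Σ[ o ∈ Ordered (ints s #1) ] At.Best (ints s #1) o (suc g) last (reals s #0 0) × 0# <ʳ reals s #0 0 ×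
    At.Trace (ints s #1) o (suc g) (ints s #9 0) (ints s #5 0) (ints s #6 0) (reals s #0 0) (ints s #0)

  trace-body : ∀ {s} → Tracing s → 0 < ints s #9 0 →
    wp trace-step (λ s′ → Tracing s′ × ints s′ #5 0 + ints s′ #9 0 < ints s #5 0 + ints s #9 0) s
  trace-body {s} (o , b , pos , tr) 0<r =
    i<n , ai<n , i<n , ai<n , j<n , aj<n , j<n , aj<n ,
    (λ gap<v → let skipped = At.trace-skip a o tr 0<r gap<v in
      _ , ∸1≤W (ℕₚ.<⇒≤ i<n) , (o , b , pos , proj₂ skipped) , ℕₚ.+-monoˡ-< r (∸1-less (proj₁ skipped))) ,
    (λ v≤gap → _ , ∸1≤W (ℕₚ.<⇒≤ r<n) , ℕₚ.≤-<-trans (ℕₚ.m∸n≤m r 1) r<n , i<n ,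
      (o , b , pos , At.trace-take a o tr 0<r pos v≤gap 
        (update-spec (update (update (ints s) #9 0 (r ∸ 1)) #6 0 i) #0 (r ∸ 1) (a i))) ,
      ℕₚ.+-monoʳ-< i (∸1-less 0<r))
    where
    a = ints s #1
    i = ints s #5 0
    j = ints s #6 0
    r = ints s #9 0
    open Ordered o
    open At.Trace a o tr using (j<n; i≤j; r≤k)
    i<n : i < n
    i<n = ℕₚ.≤-<-trans i≤j j<n
    ai<n : a i < n
    ai<n = index<n i i<n
    aj<n : a j < n
    aj<n = index<n j j<n
    r<n : r < n
    r<n = ℕₚ.≤-<-trans r≤k p≤n

  trace-output : ∀ s → Tracing s → ints s #9 0 ≤ 0 → Output s
  trace-output s (o , b , _ , tr) r≤0 = p≤n , certify-array {g} (ints s #0)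
    (λ m m<p → chosen m (from m) (s≤s⁻¹ m<p))
    (λ m 1+m<p → rising m (from m) (s≤s⁻¹ 1+m<p))
    (λ m 1+m<p → gaps m (from m) (s≤s⁻¹ 1+m<p))
    top (At.Best.maximal b)
    where
    open At.Trace (ints s #1) o tr using (chosen; rising; gaps)
    from : ∀ m → ints s #9 0 ≤ m
    from m = ℕₚ.≤-trans r≤0 z≤n
    top : ∀ m → m < n → inputPoint m ≼ At.at (ints s #1) o last
    top m m<n with At.position (ints s #1) o (fromℕ< m<n)
    ... | l , l<n , eq = subst (_≼ At.at (ints s #1) o last) (sym (trans (inputPoint-fromℕ< m<n) eq))
          (At.at-mono (ints s #1) o (ℕₚ.≤-pred (subst (l <_) (sym 1+last≡n) l<n)) last<n)

  trace-runs : ∀ {s} → ints s #9 0 ≡ suc g → Computed (suc g) s → Runs trace s (trace-time n) Output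
  trace-runs {s} r≡ (o , _ , all) = straight trace-start
      {Q = λ s → Tracing s × ints s #5 0 + ints s #9 0 ≤ n + n}
      (_ , ∸1≤W ℕₚ.≤-refl , last<n , _ , ∸1≤W ℕₚ.≤-refl , subst (_< n) (sym r≡) p≤n , last<n ,
       (o , best , positive , started) ,
       ℕₚ.+-mono-≤ (ℕₚ.<⇒≤ last<n) (subst (_≤ n) (sym r≡) (ℕₚ.<⇒≤ p≤n))) ⨟
    λ (t , ≤n+n) → relax ℕₚ.≤-refl (λ {s′} (t , r≤0) → trace-output s′ t r≤0)
      (iterate Tracing (λ s → ints s #5 0 + ints s #9 0) (costᶜ trace-step) _
        (λ {s} t 0<r → straight trace-step (trace-body {s} t 0<r)) (n + n) ≤n+n t)
    where
    best = all last last<n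
    -- As `p ≤ n`, there are `suc g` consecutive gaps ending at the last position, all positive.
    positive : 0# <ʳ reals s #1 last
    positive with At.positive-chain (ints s #1) o (suc g) (s≤s⁻¹ (ℕₚ.≤-trans p≤n (ℕₚ.≤-reflexive (sym 1+last≡n)))) last<n
    ... | v , 0<v , c = <-≤ʳ-trans 0<v (At.Best.maximal best v c)
    memory : Fin 10 → ℕ → ℕ
    memory = update (update (ints s) #5 0 last) #6 0 last
    started : At.Trace (ints s #1) o (suc g) (ints s #9 0) last last (reals s #1 last)
      (update memory #0 (ints s #9 0) (ints s #1 last) #0)
    started = subst (λ r → At.Trace (ints s #1) o (suc g) r last last (reals s #1 last)
      (update memory #0 r (ints s #1 last) #0)) (sym r≡)
      (At.start-trace (ints s #1) o last<n (At.Best.achieved best) (update-spec memory #0 (suc g) _))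

  dispersion-runs : Runs (Program.code dispersion) initial (dispersion-time n p) Output
  dispersion-runs = sort-runs ⨟ λ o → base-runs o ⨟ λ c → rows-runs c ⨟ λ (r≡ , c) → trace-runs r≡ c

-- Complexity

-- For a loop whose body is itself linear in `n`: `Q` is the logarithm for the passes of the sort
-- and `p` for the rows of the table.
outer-while-O : ∀ {n N} → 1 ≤ N → ∀ B K m {Q c e} → 1 + B + K ≤O[ c ] n → m ≤O[ e ] Q → Q * n ≤ N →
  while-time B K m ≤O[ (1 + B) + e * c ] N
outer-while-O {n} {N} 1≤N B K m {Q} {c} {e} K≤ m≤ Q*n≤N = +-O (const-O (1 + B)) (bounded (begin
  m * (1 + B + K)      ≤⟨ ℕₚ.*-mono-≤ (bound m≤) (bound K≤) ⟩
  e * Q * (c * n)      ≡⟨ ℕₚ.[m*n]*[o*p]≡[m*o]*[n*p] e Q c n ⟩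
  e * c * (Q * n)      ≤⟨ ℕₚ.*-monoʳ-≤ (e * c) Q*n≤N ⟩
  e * c * N            ∎))
  where
  open OofN 1≤N
  open ℕₚ.≤-Reasoning

≤O-mono : ∀ {T c M N} → T ≤O[ c ] M → M ≤ N → T ≤O[ c ] N
≤O-mono {c = c} T≤ M≤N = bounded (ℕₚ.≤-trans (bound T≤) (ℕₚ.*-monoʳ-≤ c M≤N))

double-O : ∀ n → n + n ≤O[ 2 ] n
double-O n = bounded (ℕₚ.≤-reflexive (cong (n +_) (sym (ℕₚ.+-identityʳ n))))

abstract
  -- The 5 is the overhead `1 + B` of the loop around a pass; for a row it is 7.
  pass-linear : ∃[ c ] (∀ {n} → 1 ≤ n → 5 + pass-time n ≤O[ c ] n)
  pass-linear = _ , λ {n} 1≤n → let open OofN 1≤n in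
    +-O (const-O 5) (+-O (const-O (costᶜ merge-start)) (+-O (while-O 4 _ n ≤O-refl)
      (+-O (const-O 3) (+-O (while-O 4 _ n ≤O-refl) (const-O 7)))))

abstract
  row-linear : ∃[ c ] (∀ {n} → 1 ≤ n → 7 + row-time n ≤O[ c ] n)
  row-linear = _ , λ {n} 1≤n → let open OofN 1≤n in
    +-O (const-O 7) (+-O (const-O (costᶜ row-start)) (+-O (while-O 4 _ (n + n) (double-O n)) (const-O 6)))

abstract
  -- From `2 ≤ n` the logarithm is at least 1, so linear terms and p n are absorbed, and the `suc L`
  -- passes are at most 2 L.
  dispersion-bounded : ∃[ c ] (∀ {n p} → 2 ≤ n → 2 ≤ p → dispersion-time n p ≤O[ c ] (p * n * ⌈log₂ n ⌉))
  dispersion-bounded = _ , λ {n} {p} 2≤n 2≤p → let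
      L    = ⌈log₂ n ⌉
      1≤n  = ℕₚ.<⇒≤ 2≤n
      1≤p  = ℕₚ.<⇒≤ 2≤p
      1≤L  = subst (_≤ L) (⌈log₂2^n⌉≡n 1) (⌈log₂⌉-mono-≤ 2≤n)
      pn≤N = subst (_≤ p * n * L) (ℕₚ.*-identityʳ (p * n)) (ℕₚ.*-monoʳ-≤ (p * n) 1≤L)
      n≤pn = subst (_≤ p * n) (ℕₚ.*-identityˡ n) (ℕₚ.*-monoˡ-≤ n 1≤p)
      n≤N  = ℕₚ.≤-trans n≤pn pn≤N
      Ln≤N = subst (_≤ p * n * L) (ℕₚ.*-comm n L) (ℕₚ.*-monoˡ-≤ L n≤pn)
      1≤N  = ℕₚ.≤-trans 1≤n n≤N
      1+L≤ = ℕₚ.≤-trans (ℕₚ.+-monoˡ-≤ L 1≤L) (ℕₚ.≤-reflexive (cong (L +_) (sym (ℕₚ.+-identityʳ L))))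
      open OofN 1≤N in
    +-O (+-O (+-O (const-O 3) (while-O 4 _ n (≤O-mono ≤O-refl n≤N)))
             (+-O (const-O 3) (outer-while-O 1≤N 4 (pass-time n) (suc L) {Q = L} {e = 2} (proj₂ pass-linear 1≤n) (bounded 1+L≤) Ln≤N)))
    (+-O (+-O (const-O 3) (while-O 4 _ n (≤O-mono ≤O-refl n≤N)))
    (+-O (+-O (const-O 3) (outer-while-O 1≤N 6 (row-time n) p {Q = p} (proj₂ row-linear 1≤n) ≤O-refl pn≤N))
         (+-O (const-O (costᶜ trace-start)) (while-O 4 _ (n + n) (≤O-mono (double-O n) n≤N)))))

n+n+n≤n^3+c : ∀ {n} c → 2 ≤ n → n + n + n ≤ n ^ (3 + c)
n+n+n≤n^3+c {n} c 2≤n = begin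
  n + n + n          ≤⟨ ℕₚ.m≤m+n (n + n + n) n ⟩
  n + n + n + n      ≡⟨ ℕₚ.+-assoc (n + n) n n ⟩
  n + n + (n + n)    ≡⟨ cong (λ m → n + n + m) (ℕₚ.+-identityʳ (n + n)) ⟨
  2 * (n + n)        ≡⟨ cong (λ m → 2 * (n + m)) (ℕₚ.+-identityʳ n) ⟨
  2 * (2 * n)        ≤⟨ ℕₚ.*-mono-≤ 2≤n (ℕₚ.*-mono-≤ 2≤n (ℕₚ.≤-reflexive (sym (ℕₚ.*-identityʳ n)))) ⟩
  n ^ 3              ≤⟨ power-≥ 3 c (ℕₚ.<⇒≤ 2≤n) ⟩
  n ^ (3 + c)        ∎
  where open ℕₚ.≤-Reasoning

n≤2^n : ∀ n → n ≤ 2 ^ n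
n≤2^n zero    = z≤n
n≤2^n (suc n) = ℕₚ.≤-trans (ℕₚ.+-mono-≤ (ℕₚ.m^n>0 2 n) (n≤2^n n))
  (ℕₚ.≤-reflexive (cong (2 ^ n +_) (sym (ℕₚ.+-identityʳ (2 ^ n)))))

⌈log₂n⌉≤n : ∀ n → ⌈log₂ n ⌉ ≤ n
⌈log₂n⌉≤n n = subst (⌈log₂ n ⌉ ≤_) (⌈log₂2^n⌉≡n n) (⌈log₂⌉-mono-≤ (n≤2^n n))

module Solutions (R : RealNumbers) (α : RealNumbers.Carrier R)
                 (0<α : RealNumbers._<ʳ_ R (RealNumbers.0# R) α) where
  open Problem R α
  open Complexity R α

  within : ∀ {P W T T′ M M′ p n} {x : Fin n → Point} → T ≤ T′ → M ≤ M′ →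
    SolvesWithin P W T M p x → SolvesWithin P W T′ M′ p x
  within T≤ M≤ (S , S≤ , t , s , run , t≤ , out) =
    S , ℕₚ.≤-trans S≤ M≤ , t , s , run , ℕₚ.≤-trans t≤ T≤ , out

  ≤-scaled : ∀ {T c N} d → T ≤O[ c ] N → T ≤ (d + c) * N
  ≤-scaled {c = c} {N} d T≤ = ℕₚ.≤-trans (bound T≤) (ℕₚ.*-monoˡ-≤ N (ℕₚ.m≤n+m c d))

  solvable-2 : SolvableIn (λ p → p ≡ 2) (λ n _ → n) (λ _ _ → 1)
  -- The constant is shared by word size, time and memory: 18 covers the memory and `c` the time.
  solvable-2 = extreme-pair , 18 + c , λ { n .2 _ 2≤n refl x pareto →
    let 1≤n = ℕₚ.<⇒≤ 2≤n ; n≤W = n≤n^1+c (17 + c) 1≤n in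
    within {P = extreme-pair} {x = x} (≤-scaled 18 (proj₂ pair-linear 1≤n))
      (ℕₚ.≤-trans (ℕₚ.m≤m+n 18 c) (ℕₚ.≤-reflexive (sym (ℕₚ.*-identityʳ (18 + c)))))
      (Pair.runs R α 0<α (n ^ (18 + c)) (ℕₚ.≤-trans 2≤n n≤W) n≤W x pareto 2≤n) }
    where
    c : ℕ
    c = proj₁ pair-linear

  solvable-3 : SolvableIn (λ p → p ≡ 3) (λ n _ → n) (λ _ _ → 1)
  solvable-3 = best-middle , 21 + c , λ { n .3 _ 3≤n refl x pareto →
    let 1≤n = ℕₚ.≤-trans (s≤s z≤n) 3≤n ; n≤W = n≤n^1+c (20 + c) 1≤n in
    within {P = best-middle} {x = x} (≤-scaled 21 (proj₂ triple-linear 1≤n))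
      (ℕₚ.≤-trans (ℕₚ.m≤m+n 21 c) (ℕₚ.≤-reflexive (sym (ℕₚ.*-identityʳ (21 + c)))))
      (Triple.runs R α 0<α (n ^ (21 + c)) (ℕₚ.≤-trans 3≤n n≤W) n≤W x pareto 3≤n) }
    where
    c : ℕ
    c = proj₁ triple-linear

  -- The factor 12 counts ten integer and two real arrays, each of length `n`.
  dispersion-solves : ∀ W {n} g (x : Fin n → Point) → IsParetoFront x → n + n + n ≤ W → suc (suc g) ≤ n →
    SolvesWithin dispersion W (dispersion-time n (suc (suc g))) (12 * n) (suc (suc g)) x
  dispersion-solves W {n} g x pareto n+n+n≤W p≤n =
    n , ℕₚ.≤-refl , DynamicProgram.dispersion-runs R α 0<α W g x pareto n+n+n≤W p≤n

  -- Stated for all `p`, it gives both polynomial solvability and the case of more than three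
  -- points.
  solvable : SolvableIn (λ _ → ⊤) (λ n p → p * n * ⌈log₂ n ⌉) (λ n _ → n)
  solvable = dispersion , 12 + c , solves
    where
    c : ℕ
    c = proj₁ dispersion-bounded
    solves : ∀ n p → 2 ≤ p → p ≤ n → ⊤ → (x : Fin n → Point) → IsParetoFront x →
      SolvesWithin dispersion (n ^ (12 + c)) ((12 + c) * (p * n * ⌈log₂ n ⌉)) ((12 + c) * n) p x
    solves n (suc zero) (s≤s ())
    solves n (suc (suc g)) 2≤p p≤n _ x pareto = within {P = dispersion} {x = x}
      (≤-scaled 12 (proj₂ dispersion-bounded 2≤n 2≤p)) (ℕₚ.*-monoˡ-≤ n (ℕₚ.m≤m+n 12 c))
      (dispersion-solves (n ^ (12 + c)) g x pareto (n+n+n≤n^3+c (9 + c) 2≤n) p≤n)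
      where
      2≤n : 2 ≤ n
      2≤n = ℕₚ.≤-trans 2≤p p≤n

  solvable-polynomially : SolvableIn (λ _ → ⊤) (λ n _ → n ^ 3) (λ n _ → n ^ 3)
  solvable-polynomially with solvable
  ... | P , c , solves = P , c , λ n p 2≤p p≤n _ x pareto → within {P = P} {x = x}
    (ℕₚ.*-monoʳ-≤ c (ℕₚ.≤-trans (ℕₚ.*-mono-≤ (ℕₚ.*-monoˡ-≤ n p≤n) (⌈log₂n⌉≤n n)) (ℕₚ.≤-reflexive
      (trans (ℕₚ.*-assoc n n n) (cong (λ m → n * (n * m)) (sym (ℕₚ.*-identityʳ n)))))))
    (ℕₚ.*-monoʳ-≤ c (n≤n^1+c 2 (ℕₚ.≤-trans (s≤s z≤n) (ℕₚ.≤-trans 2≤p p≤n))))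
    (solves n p 2≤p p≤n tt x pareto)

theorem2 : (R : RealNumbers) → (let open RealNumbers R) → (α : Carrier) → 0# <ʳ α →
    (let open Complexity R α) →
    (∃[ m ] SolvableIn (λ _ → ⊤) (λ n _ → n ^ m) (λ n _ → n ^ m)) ×
    SolvableIn (λ p → p ≡ 2) (λ n _ → n) (λ _ _ → 1) ×
    SolvableIn (λ p → p ≡ 3) (λ n _ → n) (λ _ _ → 1) ×
    SolvableIn (λ p → 3 < p) (λ n p → p * n * ⌈log₂ n ⌉) (λ n _ → n)
theorem2 R α 0<α = (3 , solvable-polynomially) , solvable-2 , solvable-3 ,
  map₂ (map₂ λ solves n p 2≤p p≤n _ → solves n p 2≤p p≤n tt) solvable
  where open Solutions R α 0<α
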